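{- Let $\mathcal{M}$ be a positroid on $[n]$ without loops or coloops, with associated (fixed-point-free) decorated permutation $\pi$, and let $E\subseteq[n]$ be a cyclic interval. Then $E$ is a flat of $\mathcal{M}$ if and only if its complement $E^c=[n]\setminus E$ is covered by CCW-arrows of $\pi$.
   Context: A positroid of rank $d$ on $[n]=\{1,\dots,n\}$ is a matroid whose bases are the column sets of the nonzero maximal minors of some real $d\times n$ matrix of rank $d$ all of whose maximal minors are nonnegative. The cyclically shifted order $<_i$ on $[n]$ is $i<_i i+1<_i\cdots<_i n<_i 1<_i\cdots<_i i-1$. For $a,b\in[n]$ the cyclic interval is $[a,b]=\{x\in[n]: x\le_a b\}$ (nonempty; $[a,a-1]=[n]$, indices mod $n$). Decorated permutation of a loopless and coloopless positroid $\mathcal{M}$ with rank function $\operatorname{rk}$: it is the permutation $\pi$ of $[n]$ (without fixed points) for which $\pi(i)$ is the first element $j$ in the list $i+1,i+2,\dots,i-1$ (cyclically) such that $\operatorname{rk}(\{i,i+1,\dots,j\})=\operatorname{rk}(\{i+1,\dots,j\})$. A CCW-arrow of $\pi$ is a cyclic interval of the form $[x,\pi^{ -1}(x)]$, $x\in[n]$. A set $S\subseteq[n]$ is covered by CCW-arrows of $\pi$ if each element of $S$ is contained in some CCW-arrow of $\pi$ that is itself contained in $S$ (vacuously true for $S=\emptyset$). -}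

module Defs where

open import Algebra.Bundles.Raw using (RawRing)
import Algebra.Definitions.RawSemiring as RawSemiringOps
open import Data.Fin.Base using (Fin; zero; suc; toℕ; punchIn; cast)
open import Data.Fin.Permutation using (Permutation′; _⟨$⟩ʳ_; _⟨$⟩ˡ_)
open import Data.Fin.Properties using (nonZeroIndex)
open import Data.Fin.Subset
  using (Subset; inside; outside; _∈_; _∉_; _⊆_; _∪_; _-_; ⁅_⁆; ∣_∣)
open import Data.Fin.Subset.Properties using (_⊆?_; anySubset?)
open import Data.List.Base as List using (List; filter)
open import Data.List.Extrema.Nat using (max)
open import Data.Nat.Base as ℕ using (ℕ; zero; suc)
open import Data.Nat.DivMod using (_%_; _mod_)
import Data.Nat.Properties as ℕₚ
open import Data.Product.Base using (Σ-syntax; ∃-syntax; _×_; _,_)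
open import Data.Rational.Base as ℚ using (ℚ; 0ℚ; 1ℚ; ½)
import Data.Rational.Properties as ℚₚ
open import Data.Rational.Solver using (module +-*-Solver)
open import Data.Vec.Base using ([]; _∷_; tabulate)
open import Function.Bundles using (_⇔_)
open import Level using (0ℓ)
open import Relation.Binary.PropositionalEquality
  using (_≡_; _≢_; refl; sym; trans; cong; subst)
open import Relation.Nullary using (¬_; Dec; does)
open import Relation.Nullary.Decidable using (_×-dec_)
open import Relation.Unary using (Decidable)

private
  variable
    d n : ℕ

-- A real number is a Cauchy sequence of rationals; equality of reals is _≈_.
IsCauchy : (ℕ → ℚ) → Set
IsCauchy x = ∀ ε → 0ℚ ℚ.< ε →
  ∃[ N ] ∀ i j → N ℕ.≤ i → N ℕ.≤ j → ℚ.∣ x i ℚ.- x j ∣ ℚ.< ε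

record ℝ : Set where
  constructor mkℝ
  field
    seq    : ℕ → ℚ
    cauchy : IsCauchy seq

open ℝ public

infix 4 _≈_ _≤ᴿ_

_≈_ : ℝ → ℝ → Set
x ≈ y = ∀ ε → 0ℚ ℚ.< ε → ∃[ N ] ∀ i → N ℕ.≤ i → ℚ.∣ seq x i ℚ.- seq y i ∣ ℚ.< ε

_≤ᴿ_ : ℝ → ℝ → Set
x ≤ᴿ y = ∀ ε → 0ℚ ℚ.< ε → ∃[ N ] ∀ i → N ℕ.≤ i → seq x i ℚ.< seq y i ℚ.+ ε

private
  const-cauchy : ∀ q → IsCauchy (λ _ → q)
  const-cauchy q ε 0<ε =
    0 , λ _ _ _ _ → subst (ℚ._< ε) (sym (cong ℚ.∣_∣ (ℚₚ.+-inverseʳ q))) 0<ε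

  0<½ε : ∀ {ε} → 0ℚ ℚ.< ε → 0ℚ ℚ.< ½ ℚ.* ε
  0<½ε {ε} 0<ε = ℚₚ.positive⁻¹ _ {{ℚₚ.pos*pos⇒pos ½ ε {{ℚ.positive 0<ε}}}}

  ½+½ : ∀ ε → ½ ℚ.* ε ℚ.+ ½ ℚ.* ε ≡ ε
  ½+½ = solve 1 (λ e → con ½ :* e :+ con ½ :* e := e) refl
    where open +-*-Solver

  +-cauchy : ∀ x y → IsCauchy x → IsCauchy y → IsCauchy (λ i → x i ℚ.+ y i)
  +-cauchy x y cx cy ε 0<ε =
    let (N₁ , p₁) = cx (½ ℚ.* ε) (0<½ε 0<ε)
        (N₂ , p₂) = cy (½ ℚ.* ε) (0<½ε 0<ε)
    in N₁ ℕ.⊔ N₂ , λ i j N≤i N≤j → begin-strict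
      ℚ.∣ (x i ℚ.+ y i) ℚ.- (x j ℚ.+ y j) ∣
        ≡⟨ cong ℚ.∣_∣ (rearrange (x i) (y i) (x j) (y j)) ⟩
      ℚ.∣ (x i ℚ.- x j) ℚ.+ (y i ℚ.- y j) ∣
        ≤⟨ ℚₚ.∣p+q∣≤∣p∣+∣q∣ (x i ℚ.- x j) (y i ℚ.- y j) ⟩
      ℚ.∣ x i ℚ.- x j ∣ ℚ.+ ℚ.∣ y i ℚ.- y j ∣
        <⟨ ℚₚ.+-mono-<
             (p₁ i j (ℕₚ.m⊔n≤o⇒m≤o N₁ N₂ N≤i) (ℕₚ.m⊔n≤o⇒m≤o N₁ N₂ N≤j))
             (p₂ i j (ℕₚ.m⊔n≤o⇒n≤o N₁ N₂ N≤i) (ℕₚ.m⊔n≤o⇒n≤o N₁ N₂ N≤j)) ⟩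
      ½ ℚ.* ε ℚ.+ ½ ℚ.* ε
        ≡⟨ ½+½ ε ⟩
      ε ∎
    where
    open ℚₚ.≤-Reasoning
    rearrange : ∀ a b c e →
      (a ℚ.+ b) ℚ.- (c ℚ.+ e) ≡ (a ℚ.- c) ℚ.+ (b ℚ.- e)
    rearrange = solve 4 (λ a b c e →
      (a :+ b) :- (c :+ e) := (a :- c) :+ (b :- e)) refl
      where open +-*-Solver

  neg-cauchy : ∀ x → IsCauchy x → IsCauchy (λ i → ℚ.- x i)
  neg-cauchy x cx ε 0<ε =
    let (N , p) = cx ε 0<ε
    in N , λ i j N≤i N≤j →
      subst (ℚ._< ε) (trans (sym (ℚₚ.∣-p∣≡∣p∣ (x i ℚ.- x j)))
                            (cong ℚ.∣_∣ (rearrange (x i) (x j))))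
            (p i j N≤i N≤j)
    where
    rearrange : ∀ a b → ℚ.- (a ℚ.- b) ≡ (ℚ.- a) ℚ.- (ℚ.- b)
    rearrange = solve 2 (λ a b → :- (a :- b) := (:- a) :- (:- b)) refl
      where open +-*-Solver

  eventually-bounded : ∀ x → IsCauchy x →
    ∃[ K ] ℚ.Positive K × ∃[ N ] ∀ i → N ℕ.≤ i → ℚ.∣ x i ∣ ℚ.≤ K
  eventually-bounded x cx =
    let (N , p) = cx 1ℚ (ℚₚ.positive⁻¹ 1ℚ)
    in 1ℚ ℚ.+ ℚ.∣ x N ∣
     , ℚₚ.pos+nonNeg⇒pos 1ℚ ℚ.∣ x N ∣ {{ℚₚ.∣-∣-nonNeg (x N)}}
     , N
     , λ i N≤i → begin
         ℚ.∣ x i ∣                          ≡⟨ cong ℚ.∣_∣ (split (x i) (x N)) ⟩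
         ℚ.∣ (x i ℚ.- x N) ℚ.+ x N ∣        ≤⟨ ℚₚ.∣p+q∣≤∣p∣+∣q∣ (x i ℚ.- x N) (x N) ⟩
         ℚ.∣ x i ℚ.- x N ∣ ℚ.+ ℚ.∣ x N ∣    ≤⟨ ℚₚ.+-monoˡ-≤ ℚ.∣ x N ∣ (ℚₚ.<⇒≤ (p i N N≤i ℕₚ.≤-refl)) ⟩
         1ℚ ℚ.+ ℚ.∣ x N ∣                   ∎
    where
    open ℚₚ.≤-Reasoning
    split : ∀ a b → a ≡ (a ℚ.- b) ℚ.+ b
    split = solve 2 (λ a b → a := (a :- b) :+ b) refl
      where open +-*-Solver

  *-cauchy′ : ∀ x y Kx Ky .{{_ : ℚ.Positive Kx}} .{{_ : ℚ.Positive Ky}} →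
    (∃[ M ] ∀ i → M ℕ.≤ i → ℚ.∣ x i ∣ ℚ.≤ Kx) →
    (∃[ M ] ∀ i → M ℕ.≤ i → ℚ.∣ y i ∣ ℚ.≤ Ky) →
    IsCauchy x → IsCauchy y → IsCauchy (λ i → x i ℚ.* y i)
  *-cauchy′ x y Kx Ky (M₁ , q₁) (M₂ , q₂) cx cy ε 0<ε =
    let (N₁ , p₁) = cx δ 0<δ
        (N₂ , p₂) = cy δ 0<δ
        N  = (N₁ ℕ.⊔ N₂) ℕ.⊔ (M₁ ℕ.⊔ M₂)
        N₁≤ : ∀ {i} → N ℕ.≤ i → N₁ ℕ.≤ i
        N₁≤ h = ℕₚ.m⊔n≤o⇒m≤o N₁ N₂ (ℕₚ.m⊔n≤o⇒m≤o (N₁ ℕ.⊔ N₂) (M₁ ℕ.⊔ M₂) h)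
        N₂≤ : ∀ {i} → N ℕ.≤ i → N₂ ℕ.≤ i
        N₂≤ h = ℕₚ.m⊔n≤o⇒n≤o N₁ N₂ (ℕₚ.m⊔n≤o⇒m≤o (N₁ ℕ.⊔ N₂) (M₁ ℕ.⊔ M₂) h)
        M₁≤ : ∀ {i} → N ℕ.≤ i → M₁ ℕ.≤ i
        M₁≤ h = ℕₚ.m⊔n≤o⇒m≤o M₁ M₂ (ℕₚ.m⊔n≤o⇒n≤o (N₁ ℕ.⊔ N₂) (M₁ ℕ.⊔ M₂) h)
        M₂≤ : ∀ {i} → N ℕ.≤ i → M₂ ℕ.≤ i
        M₂≤ h = ℕₚ.m⊔n≤o⇒n≤o M₁ M₂ (ℕₚ.m⊔n≤o⇒n≤o (N₁ ℕ.⊔ N₂) (M₁ ℕ.⊔ M₂) h)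
    in N , λ i j N≤i N≤j → begin-strict
      ℚ.∣ x i ℚ.* y i ℚ.- x j ℚ.* y j ∣
        ≡⟨ cong ℚ.∣_∣ (rearrange (x i) (y i) (x j) (y j)) ⟩
      ℚ.∣ x i ℚ.* (y i ℚ.- y j) ℚ.+ y j ℚ.* (x i ℚ.- x j) ∣
        ≤⟨ ℚₚ.∣p+q∣≤∣p∣+∣q∣ (x i ℚ.* (y i ℚ.- y j)) (y j ℚ.* (x i ℚ.- x j)) ⟩
      ℚ.∣ x i ℚ.* (y i ℚ.- y j) ∣ ℚ.+ ℚ.∣ y j ℚ.* (x i ℚ.- x j) ∣
        <⟨ ℚₚ.+-mono-< (scale Kx (x i) _ (q₁ i (M₁≤ N≤i)) (p₂ i j (N₂≤ N≤i) (N₂≤ N≤j)))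
                       (scale Ky (y j) _ (q₂ j (M₂≤ N≤j)) (p₁ i j (N₁≤ N≤i) (N₁≤ N≤j))) ⟩
      Kx ℚ.* δ ℚ.+ Ky ℚ.* δ
        ≡⟨ ℚₚ.*-distribʳ-+ δ Kx Ky ⟨
      (Kx ℚ.+ Ky) ℚ.* δ
        ≡⟨ ℚₚ.*-assoc (Kx ℚ.+ Ky) (ℚ.1/ (Kx ℚ.+ Ky)) ε ⟨
      (Kx ℚ.+ Ky) ℚ.* ℚ.1/ (Kx ℚ.+ Ky) ℚ.* ε
        ≡⟨ cong (ℚ._* ε) (ℚₚ.*-inverseʳ (Kx ℚ.+ Ky)) ⟩
      1ℚ ℚ.* ε
        ≡⟨ ℚₚ.*-identityˡ ε ⟩
      ε ∎
    where
    open ℚₚ.≤-Reasoning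
    instance
      K>0 : ℚ.Positive (Kx ℚ.+ Ky)
      K>0 = ℚₚ.pos+pos⇒pos Kx Ky
      K≢0 : ℚ.NonZero (Kx ℚ.+ Ky)
      K≢0 = ℚₚ.pos⇒nonZero (Kx ℚ.+ Ky)
    δ : ℚ
    δ = ℚ.1/ (Kx ℚ.+ Ky) ℚ.* ε
    0<δ : 0ℚ ℚ.< δ
    0<δ = ℚₚ.positive⁻¹ δ
      {{ℚₚ.pos*pos⇒pos (ℚ.1/ (Kx ℚ.+ Ky)) {{ℚₚ.1/pos⇒pos (Kx ℚ.+ Ky)}} ε {{ℚ.positive 0<ε}}}}
    scale : ∀ K .{{_ : ℚ.Positive K}} a b →
      ℚ.∣ a ∣ ℚ.≤ K → ℚ.∣ b ∣ ℚ.< δ → ℚ.∣ a ℚ.* b ∣ ℚ.< K ℚ.* δ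
    scale K a b a≤K b<δ = begin-strict
      ℚ.∣ a ℚ.* b ∣         ≡⟨ ℚₚ.∣p*q∣≡∣p∣*∣q∣ a b ⟩
      ℚ.∣ a ∣ ℚ.* ℚ.∣ b ∣   ≤⟨ ℚₚ.*-monoʳ-≤-nonNeg ℚ.∣ b ∣ {{ℚₚ.∣-∣-nonNeg b}} a≤K ⟩
      K ℚ.* ℚ.∣ b ∣         <⟨ ℚₚ.*-monoʳ-<-pos K b<δ ⟩
      K ℚ.* δ               ∎
    rearrange : ∀ a b c e →
      a ℚ.* b ℚ.- c ℚ.* e ≡ a ℚ.* (b ℚ.- e) ℚ.+ e ℚ.* (a ℚ.- c)
    rearrange = solve 4 (λ a b c e →
      a :* b :- c :* e := a :* (b :- e) :+ e :* (a :- c)) refl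
      where open +-*-Solver

  *-cauchy : ∀ x y → IsCauchy x → IsCauchy y → IsCauchy (λ i → x i ℚ.* y i)
  *-cauchy x y cx cy =
    let (Kx , Kx>0 , bx) = eventually-bounded x cx
        (Ky , Ky>0 , by) = eventually-bounded y cy
    in *-cauchy′ x y Kx Ky {{Kx>0}} {{Ky>0}} bx by cx cy

0ℝ 1ℝ : ℝ
0ℝ = mkℝ (λ _ → 0ℚ) (const-cauchy 0ℚ)
1ℝ = mkℝ (λ _ → 1ℚ) (const-cauchy 1ℚ)

infix  8 -ᴿ_
infixl 7 _*ᴿ_
infixl 6 _+ᴿ_

_+ᴿ_ _*ᴿ_ : ℝ → ℝ → ℝ
mkℝ x cx +ᴿ mkℝ y cy = mkℝ (λ i → x i ℚ.+ y i) (+-cauchy x y cx cy)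
mkℝ x cx *ᴿ mkℝ y cy = mkℝ (λ i → x i ℚ.* y i) (*-cauchy x y cx cy)

-ᴿ_ : ℝ → ℝ
-ᴿ mkℝ x cx = mkℝ (λ i → ℚ.- x i) (neg-cauchy x cx)

ℝ-rawRing : RawRing 0ℓ 0ℓ
ℝ-rawRing = record
  { Carrier = ℝ ; _≈_ = _≈_ ; _+_ = _+ᴿ_ ; _*_ = _*ᴿ_ ; -_ = -ᴿ_ ; 0# = 0ℝ ; 1# = 1ℝ }

Matrix : ℕ → ℕ → Set
Matrix d n = Fin d → Fin n → ℝ

open RawSemiringOps (RawRing.rawSemiring ℝ-rawRing) using (sum; _^_)

-- Laplace expansion along the first row.
det : Matrix d d → ℝ
det {zero}  A = 1ℝ
det {suc d} A =
  sum λ j → (-ᴿ 1ℝ) ^ toℕ j *ᴿ (A zero j *ᴿ det (λ r c → A (suc r) (punchIn j c)))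

-- A d × n matrix has rank d iff its d rows are linearly independent.
FullRank : Matrix d n → Set
FullRank {d} {n} A = (c : Fin d → ℝ) →
  (∀ j → sum (λ i → c i *ᴿ A i j) ≈ 0ℝ) → ∀ i → c i ≈ 0ℝ

-- The increasing enumeration of the elements of a subset.
elements : (B : Subset n) → Fin ∣ B ∣ → Fin n
elements (inside  ∷ B) zero    = zero
elements (inside  ∷ B) (suc i) = suc (elements B i)
elements (outside ∷ B) i       = suc (elements B i)

-- The maximal minor with column set B, columns in their usual order.
minor : (A : Matrix d n) (B : Subset n) → ∣ B ∣ ≡ d → ℝ
minor A B ∣B∣≡d = det (λ i j → A i (elements B (cast (sym ∣B∣≡d) j)))

record Matroid (n : ℕ) : Set₁ where
  field
    Basis    : Subset n → Set
    basis?   : Decidable Basis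
    nonempty : ∃[ B ] Basis B
    exchange : ∀ {A B} → Basis A → Basis B → ∀ {x} → x ∈ A → x ∉ B →
               ∃[ y ] y ∈ B × y ∉ A × Basis ((A - x) ∪ ⁅ y ⁆)

subsets : ∀ n → List (Subset n)
subsets zero    = List.[ [] ]
subsets (suc n) =
  List.map (outside ∷_) (subsets n) List.++ List.map (inside ∷_) (subsets n)

module _ (M : Matroid n) where
  open Matroid M

  Independent : Subset n → Set
  Independent I = ∃[ B ] Basis B × I ⊆ B

  independent? : Decidable Independent
  independent? I = anySubset? (λ B → basis? B ×-dec (I ⊆? B))

  rk : Subset n → ℕ
  rk S = max 0 (List.map ∣_∣ (filter (λ I → independent? I ×-dec (I ⊆? S)) (subsets n)))

  IsLoop : Fin n → Set
  IsLoop x = ¬ Independent ⁅ x ⁆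

  IsColoop : Fin n → Set
  IsColoop x = ∀ B → Basis B → x ∈ B

  Loopless : Set
  Loopless = ∀ x → ¬ IsLoop x

  Coloopless : Set
  Coloopless = ∀ x → ¬ IsColoop x

  IsFlat : Subset n → Set
  IsFlat F = ∀ x → x ∉ F → rk F ℕ.< rk (F ∪ ⁅ x ⁆)

  IsPositroidOfRank : ℕ → Set
  IsPositroidOfRank d = Σ[ A ∈ Matrix d n ]
    FullRank A
    × (∀ B (e : ∣ B ∣ ≡ d) → 0ℝ ≤ᴿ minor A B e)
    × (∀ B → Basis B ⇔ (Σ[ e ∈ ∣ B ∣ ≡ d ] ¬ (minor A B e ≈ 0ℝ)))

  IsPositroid : Set
  IsPositroid = ∃[ d ] IsPositroidOfRank d

-- The ground set [n] is Fin n, so its labels start at 0.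
--
-- The number of cyclic successor steps from a to x.
steps : Fin n → Fin n → ℕ
steps {n} a x = _%_ (toℕ x ℕ.+ (n ℕ.∸ toℕ a)) n {{nonZeroIndex a}}

infix 4 _≤[_]_ _<[_]_

_≤[_]_ _<[_]_ : Fin n → Fin n → Fin n → Set
x ≤[ a ] y = steps a x ℕ.≤ steps a y
x <[ a ] y = steps a x ℕ.< steps a y

_≤[_]?_ : (x a y : Fin n) → Dec (x ≤[ a ] y)
x ≤[ a ]? y = steps a x ℕₚ.≤? steps a y

⟦_,_⟧ : Fin n → Fin n → Subset n
⟦ a , b ⟧ = tabulate (λ x → does (x ≤[ a ]? b))

IsCyclicInterval : Subset n → Set
IsCyclicInterval E = ∃[ a ] ∃[ b ] E ≡ ⟦ a , b ⟧

next : Fin n → Fin n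
next {n} i = _mod_ (suc (toℕ i)) n {{nonZeroIndex i}}

-- The list i+1, …, i−1 consists of the j ≢ i in the order _<[ i ]_.
IsDecoratedPermutation : Matroid n → Permutation′ n → Set
IsDecoratedPermutation M π = ∀ i →
  let j = π ⟨$⟩ʳ i in
  j ≢ i × Closes i j × (∀ k → k ≢ i → k <[ i ] j → ¬ Closes i k)
  where
  Closes : Fin _ → Fin _ → Set
  Closes i j = rk M ⟦ i , j ⟧ ≡ rk M ⟦ next i , j ⟧

IsCCWArrow : Permutation′ n → Subset n → Set
IsCCWArrow π T = ∃[ x ] T ≡ ⟦ x , π ⟨$⟩ˡ x ⟧

CoveredByCCWArrows : Permutation′ n → Subset n → Set
CoveredByCCWArrows π S = ∀ s → s ∈ S → ∃[ T ] IsCCWArrow π T × s ∈ T × T ⊆ S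

{-# OPTIONS --safe #-}
-- If π i = y, then i and y are parallel nonloops modulo the cyclic interval F
-- strictly between them, and the arrow [y, i] is the complement of F.
--
-- (⇒) If x is not in the closure of E, grow E to a maximal cyclic interval F
-- whose closure misses x.  Modulo F both neighbours of F are then parallel to
-- x, hence to each other, so they are the ends of an arrow containing x and
-- avoiding E; x itself being both neighbours would make it a coloop.
--
-- (⇐) If x in the arrow [y, i] were in the closure of E ⊆ F, some f in F would
-- be parallel to x after contracting a suitable set S, with S f y and S x i
-- bases but S f x not a basis.  As i, f, y, x are cyclically ordered, this
-- contradicts the three-term Plücker relation
--   Δ(ac) Δ(bd) = Δ(ab) Δ(cd) + Δ(ad) Δ(bc)   (a < b < c < d),
-- in which all terms are nonnegative.
module Submission where

open import Defs
open import Data.Nat.Base using (ℕ)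
open import Data.Fin.Subset using (Subset; ∁)
open import Data.Fin.Permutation using (Permutation′)
open import Function.Bundles using (_⇔_)

open import Algebra.Bundles.Raw using (RawRing)
import Algebra.Definitions.RawSemiring as RawSemiringOps
open import Data.Bool.Base using (true)
open import Data.Empty using (⊥; ⊥-elim)
open import Data.Fin.Base as Fin using (Fin; zero; suc; toℕ; punchIn; cast)
open import Data.Fin.Permutation using (_⟨$⟩ʳ_; _⟨$⟩ˡ_; inverseˡ; inverseʳ)
import Data.Fin.Properties as Finₚ
open import Data.Fin.Subset
  using (inside; outside; _∈_; _∉_; _⊆_; _⊂_; _∪_; _∩_; ⁅_⁆; ∣_∣)
  renaming (⊥ to ∅)
open import Data.Fin.Subset.Induction using (⊂-wellFounded)
open import Data.Fin.Subset.Properties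
open import Data.List.Base as List using (List; _++_)
open import Data.List.Extrema.Nat using (argmax-sel; xs≤max)
import Data.List.Membership.Propositional as List∈
import Data.List.Membership.Propositional.Properties as List∈ₚ
import Data.List.Properties as Listₚ
open import Data.List.Relation.Unary.All as All using (All)
open import Data.List.Relation.Unary.Any using (here; there)
open import Data.Nat.Base as ℕ using ()
open import Data.Nat.DivMod
  using (_%_; _mod_; m%n<n; n%n≡0; m%n%n≡m%n; [m+n]%n≡m%n; m<n⇒m%n≡m; %-distribˡ-+)
import Data.Nat.Properties as ℕₚ
open import Data.Nat.Solver using () renaming (module +-*-Solver to ℕ-Solver)
open import Data.Product.Base using (_×_; _,_; proj₁; proj₂; ∃-syntax)
open import Data.Rational.Base as ℚ using (ℚ; 0ℚ; 1ℚ; ½)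
import Data.Rational.Properties as ℚₚ
open import Data.Rational.Solver using (module +-*-Solver)
open import Data.Sum.Base using (_⊎_; inj₁; inj₂; [_,_]′)
open import Data.Vec.Base as Vec using ([]; _∷_; tabulate)
open import Data.Vec.Properties using (lookup⇒[]=; []=⇒lookup; lookup∘tabulate)
open import Function.Base using (_∘_; id)
open import Function.Bundles using (Equivalence; mk⇔)
open import Induction.WellFounded using (Acc; acc)
open import Relation.Binary.Definitions using (tri<; tri≈; tri>)
open import Relation.Binary.PropositionalEquality
  using (_≡_; _≢_; refl; sym; trans; cong; cong₂; subst; subst₂; ≢-sym; module ≡-Reasoning)
open import Relation.Nullary using (¬_; Dec; yes; no; does)
open import Relation.Nullary.Decidable using (_×-dec_; decidable-stable)
open import Relation.Unary using (Decidable)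

-- Minors and the three-term Plücker relation

-- Reals are Cauchy sequences, whose sign cannot be decided, and a basis is a column set whose
-- maximal minor is merely not null. The Plücker relation is therefore proved for the rational
-- matrix at each index, and nonnegativity serves to derive negations `¬ Δ ≈ 0`, which is what
-- membership among the bases asks for. The outcome, `Noncrossing`, is the form in which positivity
-- reaches the matroid argument. There everything is a comparison of ranks, which is decidable, so F
-- can be grown by case distinction.
--
-- In (⇒), maximality of F says that adding either neighbour makes x spanned or is adding x itself;
-- as F does not span x, exchange inverts this and makes the relation symmetric. In (⇐), S has to
-- serve two bases at once: a basis of F ∪ {x} through x exists by looplessness, and cardinality
-- then forces the second basis.

infixl 5 _⊕_

_⊕_ : ∀ {n} → Subset n → Fin n → Subset n
S ⊕ x = S ∪ ⁅ x ⁆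

⊕-comm : ∀ {n} (S : Subset n) x y → S ⊕ x ⊕ y ≡ S ⊕ y ⊕ x
⊕-comm S x y = trans (∪-assoc S _ _) (trans (cong (S ∪_) (∪-comm ⁅ x ⁆ ⁅ y ⁆)) (sym (∪-assoc S _ _)))

module _ where
  open import Data.Rational.Base using (_+_; _*_; _-_; -_)
  open +-*-Solver
  open ≡-Reasoning

  x≡-x⇒x≡0 : ∀ {x} → x ≡ - x → x ≡ 0ℚ
  x≡-x⇒x≡0 {x} x≡-x = begin
    x                  ≡⟨ solve 1 (λ a → a := con ½ :* a :+ con ½ :* a) refl x ⟩
    ½ * x + ½ * x      ≡⟨ cong (λ y → ½ * x + ½ * y) x≡-x ⟩
    ½ * x + ½ * (- x)  ≡⟨ solve 1 (λ a → con ½ :* a :+ con ½ :* (:- a) := con 0ℚ) refl x ⟩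
    0ℚ                 ∎

  module _ {X : Set} where

    Row Form : Set
    Row  = X → ℚ
    Form = List X → ℚ

    -- Lists of columns make Laplace expansion along a row α structurally
    -- recursive; it is the interior product by α.
    expand : Row → Form → Form
    expand α F List.[]       = 0ℚ
    expand α F (x List.∷ xs) = α x * F xs - expand α (F ∘ (x List.∷_)) xs

    minorForm : List Row → Form
    minorForm List.[]       List.[]      = 1ℚ
    minorForm List.[]       (_ List.∷ _) = 0ℚ
    minorForm (α List.∷ αs)              = expand α (minorForm αs)

    expand-cong : ∀ α {F G : Form} → (∀ ys → F ys ≡ G ys) → ∀ xs → expand α F xs ≡ expand α G xs
    expand-cong α F≗G List.[]       = refl
    expand-cong α F≗G (x List.∷ xs) =
      cong₂ (λ s t → α x * s - t) (F≗G xs) (expand-cong α (F≗G ∘ (x List.∷_)) xs)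

    -- Fixing the first column of a nested expansion yields exactly such a combination `c * F - G`;
    -- `c = 0` serves for negation.
    expand-linearʳ : ∀ α c (F G : Form) xs →
      expand α (λ ys → c * F ys - G ys) xs ≡ c * expand α F xs - expand α G xs
    expand-linearʳ α c F G List.[]       = solve 1 (λ c → con 0ℚ := c :* con 0ℚ :- con 0ℚ) refl c
    expand-linearʳ α c F G (x List.∷ xs) = begin
      α x * (c * F xs - G xs) - expand α (λ ys → c * F (x List.∷ ys) - G (x List.∷ ys)) xs
        ≡⟨ cong (λ t → α x * (c * F xs - G xs) - t) (expand-linearʳ α c _ _ xs) ⟩
      α x * (c * F xs - G xs) - (c * expand α (F ∘ (x List.∷_)) xs - expand α (G ∘ (x List.∷_)) xs)
        ≡⟨ solve 6 (λ a c f g f′ g′ → a :* (c :* f :- g) :- (c :* f′ :- g′)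
                                   := c :* (a :* f :- f′) :- (a :* g :- g′))
                 refl (α x) c (F xs) (G xs) _ _ ⟩
      c * expand α F (x List.∷ xs) - expand α G (x List.∷ xs) ∎

    expand-linearˡ : ∀ α c β (F : Form) xs →
      expand (λ x → α x * c - β x) F xs ≡ c * expand α F xs - expand β F xs
    expand-linearˡ α c β F List.[]       = solve 1 (λ c → con 0ℚ := c :* con 0ℚ :- con 0ℚ) refl c
    expand-linearˡ α c β F (x List.∷ xs) = begin
      (α x * c - β x) * F xs - expand (λ x → α x * c - β x) (F ∘ (x List.∷_)) xs
        ≡⟨ cong (λ t → (α x * c - β x) * F xs - t) (expand-linearˡ α c β _ xs) ⟩
      (α x * c - β x) * F xs - (c * expand α (F ∘ (x List.∷_)) xs - expand β (F ∘ (x List.∷_)) xs)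
        ≡⟨ solve 6 (λ a c b f s t → (a :* c :- b) :* f :- (c :* s :- t)
                                   := c :* (a :* f :- s) :- (b :* f :- t))
                 refl (α x) c (β x) (F xs) _ _ ⟩
      c * expand α F (x List.∷ xs) - expand β F (x List.∷ xs) ∎

    expand-vanishing : ∀ α (F : Form) xs → All (λ x → α x ≡ 0ℚ) xs → expand α F xs ≡ 0ℚ
    expand-vanishing α F List.[]       All.[]         = refl
    expand-vanishing α F (x List.∷ xs) (αx≡0 All.∷ p) =
      trans (cong₂ (λ s t → s * F xs - t) αx≡0 (expand-vanishing α _ xs p))
            (solve 1 (λ f → con 0ℚ :* f :- con 0ℚ := con 0ℚ) refl (F xs))

    expand-0ʳ : ∀ α {F : Form} → (∀ ys → F ys ≡ 0ℚ) → ∀ xs → expand α F xs ≡ 0ℚ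
    expand-0ʳ α F≡0 List.[]       = refl
    expand-0ʳ α F≡0 (x List.∷ xs) =
      trans (cong₂ (λ s t → α x * s - t) (F≡0 xs) (expand-0ʳ α (F≡0 ∘ (x List.∷_)) xs))
            (solve 1 (λ a → a :* con 0ℚ :- con 0ℚ := con 0ℚ) refl (α x))

    -- Interior products anticommute. After splitting off the first column `x`, the terms with
    -- factors `α x` and `β x` trade places with opposite signs, and the remaining term is the
    -- induction hypothesis.
    expand-anticomm : ∀ α β (F : Form) xs →
      expand α (expand β F) xs ≡ - expand β (expand α F) xs
    expand-anticomm α β F List.[]       = refl
    expand-anticomm α β F (x List.∷ xs) = begin
      α x * expand β F xs - expand α (expand β F ∘ (x List.∷_)) xs
        ≡⟨ cong (λ t → α x * expand β F xs - t) (expand-linearʳ α (β x) F (expand β Fₓ) xs) ⟩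
      α x * expand β F xs - (β x * expand α F xs - expand α (expand β Fₓ) xs)
        ≡⟨ cong (λ t → α x * expand β F xs - (β x * expand α F xs - t)) (expand-anticomm α β Fₓ xs) ⟩
      α x * expand β F xs - (β x * expand α F xs - (- expand β (expand α Fₓ) xs))
        ≡⟨ solve 5 (λ a b s t u → a :* s :- (b :* t :- (:- u)) := :- (b :* t :- (a :* s :- u)))
                 refl (α x) (β x) (expand β F xs) (expand α F xs) _ ⟩
      - (β x * expand α F xs - (α x * expand β F xs - expand β (expand α Fₓ) xs))
        ≡⟨ cong (λ t → - (β x * expand α F xs - t)) (expand-linearʳ β (α x) F (expand α Fₓ) xs) ⟨
      - expand β (expand α F) (x List.∷ xs) ∎
      where
      Fₓ = F ∘ (x List.∷_)

    -- Anticommutation carries the expansion along `α` inwards to the equal row, where it is its own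
    -- negative.
    expand-repeated-row : ∀ {α αs} → α List∈.∈ αs → ∀ xs → expand α (minorForm αs) xs ≡ 0ℚ
    expand-repeated-row (here refl)                xs = x≡-x⇒x≡0 (expand-anticomm _ _ _ xs)
    expand-repeated-row {α} {β List.∷ αs} (there p) xs =
      trans (expand-anticomm α β (minorForm αs) xs)
            (cong -_ (expand-0ʳ β (expand-repeated-row p) xs))

    -- For `G` the minor of a list of rows, putting `β` on top of them makes every determinant
    -- vanish; the `β` in the span of the rows have this property.
    Annihilates : Form → Row → Set
    Annihilates G β = ∀ xs → expand β G xs ≡ 0ℚ

    module _ (G : Form) where

      annihilates-linear : ∀ {α β} c → Annihilates G α → Annihilates G β →
        Annihilates G (λ x → α x * c - β x)
      annihilates-linear {α} {β} c p q xs =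
        trans (expand-linearˡ α c β G xs)
        (trans (cong₂ (λ s t → c * s - t) (p xs) (q xs))
               (solve 1 (λ c → c :* con 0ℚ :- con 0ℚ := con 0ℚ) refl c))

      annihilates-0 : Annihilates G (λ _ → 0ℚ)
      annihilates-0 xs = expand-vanishing _ G xs (All.universal (λ _ → refl) xs)

      -- The column `u` stays a parameter: expanding the other columns takes linear combinations,
      -- with coefficients `α x`, of functions of `u` that annihilate `G` already.
      annihilates-expand : ∀ α (F : X → Form) → (∀ ys → Annihilates G (λ u → F u ys)) →
        ∀ xs → Annihilates G (λ u → expand α (F u) xs)
      annihilates-expand α F p List.[]       = annihilates-0
      annihilates-expand α F p (x List.∷ xs) zs =
        trans (expand-cong′ zs)
              (annihilates-linear (α x) (p xs)
                 (annihilates-expand α (λ u → F u ∘ (x List.∷_)) (p ∘ (x List.∷_)) xs) zs)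
        where
        expand-congˡ : ∀ {β γ} → (∀ u → β u ≡ γ u) → ∀ (H : Form) zs → expand β H zs ≡ expand γ H zs
        expand-congˡ β≗γ H List.[]       = refl
        expand-congˡ β≗γ H (z List.∷ zs) =
          cong₂ (λ s t → s * H zs - t) (β≗γ z) (expand-congˡ β≗γ _ zs)
        expand-cong′ = expand-congˡ
          (λ u → cong (_- expand α (F u ∘ (x List.∷_)) xs) (ℚₚ.*-comm (α x) (F u xs))) G

      -- The first column of a minor enters linearly, through the rows.
      annihilates-minor : ∀ {αs} → All (Annihilates G) αs → ∀ xs →
        Annihilates G (λ u → minorForm αs (u List.∷ xs))
      annihilates-minor All.[]                      xs = annihilates-0
      annihilates-minor {α List.∷ αs} (p All.∷ ps) xs =
        annihilates-linear (minorForm αs xs) p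
          (annihilates-expand α (λ u → minorForm αs ∘ (u List.∷_)) (annihilates-minor ps) xs)

    Alternating : Form → Set
    Alternating F = ∀ pre x y post →
      F (pre ++ x List.∷ y List.∷ post) ≡ - F (pre ++ y List.∷ x List.∷ post)

    expand-alternating : ∀ α {F} → Alternating F → Alternating (expand α F)
    expand-alternating α {F} alt List.[] x y post = begin
      α x * F (y List.∷ post) - (α y * F (x List.∷ post) - expand α Fₓᵧ post)
        ≡⟨ solve 5 (λ a b s t u → a :* s :- (b :* t :- u) := :- (b :* t :- (a :* s :- (:- u))))
                 refl (α x) (α y) (F (y List.∷ post)) (F (x List.∷ post)) _ ⟩
      - (α y * F (x List.∷ post) - (α x * F (y List.∷ post) - (- expand α Fₓᵧ post)))
        ≡⟨ cong (λ t → - (α y * F (x List.∷ post) - (α x * F (y List.∷ post) - t)))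
                (expand-neg post) ⟨
      - expand α F (y List.∷ x List.∷ post) ∎
      where
      Fₓᵧ = λ zs → F (x List.∷ y List.∷ zs)
      Fᵧₓ = λ zs → F (y List.∷ x List.∷ zs)
      expand-neg : ∀ zs → expand α Fᵧₓ zs ≡ - expand α Fₓᵧ zs
      expand-neg zs = begin
        expand α Fᵧₓ zs
          ≡⟨ expand-cong α (λ ys → trans (alt List.[] y x ys)
               (solve 1 (λ f → :- f := con 0ℚ :* f :- f) refl (Fₓᵧ ys))) zs ⟩
        expand α (λ ys → 0ℚ * Fₓᵧ ys - Fₓᵧ ys) zs
          ≡⟨ expand-linearʳ α 0ℚ Fₓᵧ Fₓᵧ zs ⟩
        0ℚ * expand α Fₓᵧ zs - expand α Fₓᵧ zs
          ≡⟨ solve 1 (λ f → con 0ℚ :* f :- f := :- f) refl _ ⟩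
        - expand α Fₓᵧ zs ∎
    expand-alternating α {F} alt (z List.∷ pre) x y post =
      trans (cong₂ (λ s t → α z * s - t) (alt pre x y post)
                   (expand-alternating α (alt ∘ (z List.∷_)) pre x y post))
            (solve 3 (λ a s t → a :* (:- s) :- (:- t) := :- (a :* s :- t)) refl (α z) _ _)

    minorForm-alternating : ∀ αs → Alternating (minorForm αs)
    minorForm-alternating List.[]       List.[]      x y post = refl
    minorForm-alternating List.[]       (_ List.∷ _) x y post = refl
    minorForm-alternating (α List.∷ αs) = expand-alternating α (minorForm-alternating αs)

    alternating-repeated : ∀ F → Alternating F → ∀ {x xs} → x List∈.∈ xs → F (x List.∷ xs) ≡ 0ℚ
    alternating-repeated F alt (here refl) = x≡-x⇒x≡0 (alt List.[] _ _ _)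
    alternating-repeated F alt {x} {y List.∷ ys} (there p) =
      trans (alt List.[] _ _ _) (cong -_ (alternating-repeated (F ∘ (y List.∷_)) (alt ∘ (y List.∷_)) p))

    -- The linear form u ↦ [u, d, S] lies in the span of the rows, so expanding
    -- [a, b, c, S] along it gives 0; the terms indexed by S vanish.
    three-term-plücker : ∀ αs a b c d S → let [_,_] = λ u v → minorForm αs (u List.∷ v List.∷ S) in
      [ a , c ] * [ b , d ] ≡ [ a , b ] * [ c , d ] + [ a , d ] * [ b , c ]
    three-term-plücker αs a b c d S = begin
      [ a , c ] * [ b , d ]
        ≡⟨ solve 6 (λ ac bd ab cd ad bc →
             ac :* bd := ab :* cd :+ ad :* bc :- (ad :* bc :- (bd :* ac :- (cd :* ab :- con 0ℚ))))
             refl [ a , c ] [ b , d ] [ a , b ] [ c , d ] [ a , d ] [ b , c ] ⟩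
      rhs - (β a * [ b , c ] - (β b * [ a , c ] - (β c * [ a , b ] - 0ℚ)))
        ≡⟨ cong (λ t → rhs - (β a * [ b , c ] - (β b * [ a , c ] - (β c * [ a , b ] - t))))
                (expand-vanishing β _ S (All.tabulate λ s∈S →
                   alternating-repeated (minorForm αs) (minorForm-alternating αs) (there s∈S))) ⟨
      rhs - expand β (minorForm αs) (a List.∷ b List.∷ c List.∷ S)
        ≡⟨ cong (λ t → rhs - t)
                (annihilates-minor (minorForm αs) {αs} (All.tabulate expand-repeated-row) (d List.∷ S)
                   (a List.∷ b List.∷ c List.∷ S)) ⟩
      rhs - 0ℚ
        ≡⟨ solve 1 (λ t → t :- con 0ℚ := t) refl rhs ⟩
      rhs ∎
      where
      [_,_] : X → X → ℚ
      [ u , v ] = minorForm αs (u List.∷ v List.∷ S)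
      β : Row
      β u = [ u , d ]
      rhs = [ a , b ] * [ c , d ] + [ a , d ] * [ b , c ]

  -- Column sets and sorting signs

  toList : ∀ {n} → Subset n → List (Fin n)
  toList []            = List.[]
  toList (inside  ∷ B) = zero List.∷ List.map suc (toList B)
  toList (outside ∷ B) = List.map suc (toList B)

  -- The power of -1 given by the number of elements of `B` below `x`: the sign of moving column `x`
  -- from the front to its sorted place.
  sign : ∀ {n} → Subset n → Fin n → ℚ
  sign (_ ∷ _)       zero    = 1ℚ
  sign (inside ∷ B)  (suc x) = - sign B x
  sign (outside ∷ B) (suc x) = sign B x

  sign²≡1 : ∀ {n} (B : Subset n) x → sign B x * sign B x ≡ 1ℚ
  sign²≡1 (_ ∷ _)       zero    = refl
  sign²≡1 (inside ∷ B)  (suc x) =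
    trans (solve 1 (λ s → (:- s) :* (:- s) := s :* s) refl (sign B x)) (sign²≡1 B x)
  sign²≡1 (outside ∷ B) (suc x) = sign²≡1 B x

  sign-⊕-above : ∀ {n} (B : Subset n) {x y} → x Fin.< y → sign (B ⊕ y) x ≡ sign B x
  sign-⊕-above (_ ∷ _)       {zero}  {suc y} _           = refl
  sign-⊕-above (inside ∷ B)  {suc x} {suc y} (ℕ.s≤s x<y) = cong -_ (sign-⊕-above B x<y)
  sign-⊕-above (outside ∷ B) {suc x} {suc y} (ℕ.s≤s x<y) = sign-⊕-above B x<y

  alternating-map : ∀ {X Y : Set} (f : X → Y) (F : Form) → Alternating F → Alternating (F ∘ List.map f)
  alternating-map f F alt pre x y post = begin
    F (List.map f (pre ++ x List.∷ y List.∷ post))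
      ≡⟨ cong F (Listₚ.map-++ f pre _) ⟩
    F (List.map f pre ++ f x List.∷ f y List.∷ List.map f post)
      ≡⟨ alt (List.map f pre) (f x) (f y) _ ⟩
    - F (List.map f pre ++ f y List.∷ f x List.∷ List.map f post)
      ≡⟨ cong (-_ ∘ F) (Listₚ.map-++ f pre _) ⟨
    - F (List.map f (pre ++ y List.∷ x List.∷ post)) ∎

  alternating-⊕ : ∀ {n} (F : Form) → Alternating F → ∀ (B : Subset n) {x} → x ∉ B →
    F (toList (B ⊕ x)) ≡ sign B x * F (x List.∷ toList B)
  alternating-⊕ F alt (inside ∷ B)  {zero} x∉B = ⊥-elim (x∉B Vec.here)
  alternating-⊕ F alt (outside ∷ B) {zero} x∉B =
    trans (cong (λ C → F (zero List.∷ List.map suc (toList C))) (∪-identityʳ B))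
          (sym (ℚₚ.*-identityˡ _))
  alternating-⊕ F alt (inside ∷ B) {suc x} x∉B = begin
    F (zero List.∷ List.map suc (toList (B ⊕ x)))
      ≡⟨ alternating-⊕ (F ∘ (zero List.∷_) ∘ List.map suc)
           (alternating-map suc (F ∘ (zero List.∷_)) (alt ∘ (zero List.∷_))) B
                       (drop-not-there x∉B) ⟩
    sign B x * F (zero List.∷ suc x List.∷ List.map suc (toList B))
      ≡⟨ cong (sign B x *_) (alt List.[] zero (suc x) _) ⟩
    sign B x * (- F (suc x List.∷ zero List.∷ List.map suc (toList B)))
      ≡⟨ solve 2 (λ s f → s :* (:- f) := (:- s) :* f) refl (sign B x) _ ⟩
    (- sign B x) * F (suc x List.∷ zero List.∷ List.map suc (toList B)) ∎
  alternating-⊕ F alt (outside ∷ B) {suc x} x∉B =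
    alternating-⊕ (F ∘ List.map suc) (alternating-map suc F alt) B (drop-not-there x∉B)

  -- Extracting `x` first keeps the signs simple: `y` lies above `x`, so `x` passes only elements of
  -- `S`, and both signs refer to `S` alone.
  alternating-⊕⊕ : ∀ {n} (F : Form) → Alternating F → ∀ (S : Subset n) {x y} → x Fin.< y →
    x ∉ S → y ∉ S → F (toList (S ⊕ x ⊕ y)) ≡ sign S x * sign S y * F (x List.∷ y List.∷ toList S)
  alternating-⊕⊕ F alt S {x} {y} x<y x∉S y∉S = begin
    F (toList (S ⊕ x ⊕ y))
      ≡⟨ cong (F ∘ toList) (⊕-comm S x y) ⟩
    F (toList (S ⊕ y ⊕ x))
      ≡⟨ alternating-⊕ F alt (S ⊕ y) x∉S⊕y ⟩
    sign (S ⊕ y) x * F (x List.∷ toList (S ⊕ y))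
      ≡⟨ cong₂ _*_ (sign-⊕-above S x<y) (alternating-⊕ (F ∘ (x List.∷_)) (alt ∘ (x List.∷_)) S y∉S) ⟩
    sign S x * (sign S y * F (x List.∷ y List.∷ toList S))
      ≡⟨ ℚₚ.*-assoc (sign S x) (sign S y) _ ⟨
    sign S x * sign S y * F (x List.∷ y List.∷ toList S) ∎
    where
    x∉S⊕y : x ∉ S ⊕ y
    x∉S⊕y p = [ x∉S , (λ q → Finₚ.<⇒≢ x<y (x∈⁅y⁆⇒x≡y y q)) ]′ (x∈p∪q⁻ S ⁅ y ⁆ p)

  -- All three products carry the same sign, the product of the four signs.
  sorted-three-term-plücker : ∀ {n} (αs : List Row) (S : Subset n) {a b c d} →
    a Fin.< b → b Fin.< c → c Fin.< d → a ∉ S → b ∉ S → c ∉ S → d ∉ S →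
    let p = λ u v → minorForm αs (toList (S ⊕ u ⊕ v)) in
    p a c * p b d ≡ p a b * p c d + p a d * p b c
  sorted-three-term-plücker αs S {a} {b} {c} {d} a<b b<c c<d a∉S b∉S c∉S d∉S = begin
    p a c * p b d
      ≡⟨ cong₂ _*_ (sorted a<c a∉S c∉S) (sorted b<d b∉S d∉S) ⟩
    sa * sc * [ a , c ] * (sb * sd * [ b , d ])
      ≡⟨ solve 6 (λ sa sb sc sd ac bd → sa :* sc :* ac :* (sb :* sd :* bd) :=
                                        sa :* sb :* sc :* sd :* (ac :* bd))
               refl sa sb sc sd [ a , c ] [ b , d ] ⟩
    sa * sb * sc * sd * ([ a , c ] * [ b , d ])
      ≡⟨ cong (sa * sb * sc * sd *_) (three-term-plücker αs a b c d (toList S)) ⟩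
    sa * sb * sc * sd * ([ a , b ] * [ c , d ] + [ a , d ] * [ b , c ])
      ≡⟨ solve 8 (λ sa sb sc sd ab cd ad bc →
                    sa :* sb :* sc :* sd :* (ab :* cd :+ ad :* bc) :=
                    sa :* sb :* ab :* (sc :* sd :* cd) :+ sa :* sd :* ad :* (sb :* sc :* bc))
               refl sa sb sc sd [ a , b ] [ c , d ] [ a , d ] [ b , c ] ⟩
    sa * sb * [ a , b ] * (sc * sd * [ c , d ]) + sa * sd * [ a , d ] * (sb * sc * [ b , c ])
      ≡⟨ cong₂ _+_ (cong₂ _*_ (sorted a<b a∉S b∉S) (sorted c<d c∉S d∉S))
                   (cong₂ _*_ (sorted (ℕₚ.<-trans a<c c<d) a∉S d∉S) (sorted b<c b∉S c∉S)) ⟨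
    p a b * p c d + p a d * p b c ∎
    where
    p : Fin _ → Fin _ → ℚ
    p u v = minorForm αs (toList (S ⊕ u ⊕ v))
    [_,_] : Fin _ → Fin _ → ℚ
    [ u , v ] = minorForm αs (u List.∷ v List.∷ toList S)
    sa = sign S a
    sb = sign S b
    sc = sign S c
    sd = sign S d
    a<c = ℕₚ.<-trans a<b b<c
    b<d = ℕₚ.<-trans b<c c<d
    sorted : ∀ {x y} → x Fin.< y → x ∉ S → y ∉ S → p x y ≡ sign S x * sign S y * [ x , y ]
    sorted = alternating-⊕⊕ (minorForm αs) (minorForm-alternating αs) S

-- Determinants of Cauchy reals, index by index

module ℝΣ = RawSemiringOps (RawRing.rawSemiring ℝ-rawRing)
module ℚΣ = RawSemiringOps (RawRing.rawSemiring ℚₚ.+-*-rawRing)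

module _ where
  open import Data.Rational.Base using (_+_; _*_; _-_; -_)
  open +-*-Solver
  open ≡-Reasoning

  sum-cong : ∀ {m} {g h : Fin m → ℚ} → (∀ j → g j ≡ h j) → ℚΣ.sum g ≡ ℚΣ.sum h
  sum-cong {ℕ.zero}  g≗h = refl
  sum-cong {ℕ.suc m} g≗h = cong₂ _+_ (g≗h zero) (sum-cong (g≗h ∘ suc))

  -- The factor `s` carries the sign of the columns already passed, so that the sum over the tail,
  -- which begins with the opposite sign, is again of the stated form.
  expand-Laplace : ∀ {X : Set} (α : X → ℚ) (F : Form) {m} (f : Fin (ℕ.suc m) → X) s →
    ℚΣ.sum (λ j → s * (- 1ℚ) ℚΣ.^ toℕ j * (α (f j) * F (List.tabulate (f ∘ punchIn j))))
      ≡ s * expand α F (List.tabulate f)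
  expand-Laplace α F {ℕ.zero} f s =
    solve 3 (λ s a t → s :* con 1ℚ :* (a :* t) :+ con 0ℚ := s :* (a :* t :- con 0ℚ))
          refl s (α (f zero)) (F List.[])
  expand-Laplace α F {ℕ.suc m} f s = begin
    s * 1ℚ * (α (f zero) * F fs) + _
      ≡⟨ cong (s * 1ℚ * (α (f zero) * F fs) +_) (sum-cong λ j →
           cong (_* (α (f (suc j)) * Fₓ (List.tabulate (f ∘ suc ∘ punchIn j))))
                (sym (ℚₚ.*-assoc s (- 1ℚ) ((- 1ℚ) ℚΣ.^ toℕ j)))) ⟩
    s * 1ℚ * (α (f zero) * F fs) + _
      ≡⟨ cong (s * 1ℚ * (α (f zero) * F fs) +_) (expand-Laplace α Fₓ (f ∘ suc) (s * (- 1ℚ))) ⟩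
    s * 1ℚ * (α (f zero) * F fs) + s * (- 1ℚ) * expand α Fₓ fs
      ≡⟨ solve 4 (λ s a t e → s :* con 1ℚ :* (a :* t) :+ s :* con (- 1ℚ) :* e := s :* (a :* t :- e))
               refl s (α (f zero)) (F fs) _ ⟩
    s * expand α F (List.tabulate f) ∎
    where
    fs = List.tabulate (f ∘ suc)
    Fₓ = F ∘ (f zero List.∷_)

  seq-sum : ∀ i {m} (g : Fin m → ℝ) → seq (ℝΣ.sum g) i ≡ ℚΣ.sum (λ j → seq (g j) i)
  seq-sum i {ℕ.zero}  g = refl
  seq-sum i {ℕ.suc m} g = cong (seq (g zero) i +_) (seq-sum i (g ∘ suc))

  seq-^ : ∀ i x k → seq (x ℝΣ.^ k) i ≡ seq x i ℚΣ.^ k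
  seq-^ i x ℕ.zero    = refl
  seq-^ i x (ℕ.suc k) = cong (seq x i *_) (seq-^ i x k)

  rowsAt : ∀ {d} {X : Set} → (Fin d → X → ℝ) → ℕ → List (X → ℚ)
  rowsAt A i = List.tabulate (λ r x → seq (A r x) i)

  -- Ring operations on `ℝ` act termwise, so the determinant commutes with reading off index `i`.
  -- The relabelling `f` keeps the statement closed under deleting columns by `punchIn`.
  seq-det : ∀ {d} {X : Set} i (A : Fin d → X → ℝ) (f : Fin d → X) →
    seq (det (λ r c → A r (f c))) i ≡ minorForm (rowsAt A i) (List.tabulate f)
  seq-det {ℕ.zero}  i A f = refl
  seq-det {ℕ.suc d} i A f = begin
    _ ≡⟨ seq-sum i (λ j → (-ᴿ 1ℝ) ℝΣ.^ toℕ j *ᴿ (A zero (f j) *ᴿ det (λ r c → A (suc r) (f (punchIn j c))))) ⟩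
    _ ≡⟨ sum-cong (λ j → cong₂ _*_
           (trans (seq-^ i (-ᴿ 1ℝ) (toℕ j)) (sym (ℚₚ.*-identityˡ ((- 1ℚ) ℚΣ.^ toℕ j))))
           (cong (seq (A zero (f j)) i *_) (seq-det i (A ∘ suc) (f ∘ punchIn j)))) ⟩
    _ ≡⟨ expand-Laplace (λ x → seq (A zero x) i) (minorForm (rowsAt (A ∘ suc) i)) f 1ℚ ⟩
    _ ≡⟨ ℚₚ.*-identityˡ _ ⟩
    minorForm (rowsAt A i) (List.tabulate f) ∎

toList-elements : ∀ {n} (B : Subset n) → List.tabulate (elements B) ≡ toList B
toList-elements []            = refl
toList-elements (inside  ∷ B) =
  cong (zero List.∷_) (trans (sym (Listₚ.map-tabulate (elements B) suc))
                             (cong (List.map suc) (toList-elements B)))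
toList-elements (outside ∷ B) =
  trans (sym (Listₚ.map-tabulate (elements B) suc)) (cong (List.map suc) (toList-elements B))

seq-minor′ : ∀ {d n} i (A : Matrix d n) B (e : ∣ B ∣ ≡ d) →
  seq (minor A B e) i ≡ minorForm (rowsAt A i) (List.tabulate (λ j → elements B (cast (sym e) j)))
seq-minor′ i A B e = seq-det i A (λ j → elements B (cast (sym e) j))

seq-minor : ∀ {d n} i (A : Matrix d n) B (e : ∣ B ∣ ≡ d) →
  seq (minor A B e) i ≡ minorForm (rowsAt A i) (toList B)
seq-minor i A B e = trans (seq-minor′ i A B e) (cong (minorForm (rowsAt A i)) (lem e))
  where
  lem : ∀ {d} (e : ∣ B ∣ ≡ d) → List.tabulate (λ j → elements B (cast (sym e) j)) ≡ toList B
  lem refl = trans (Listₚ.tabulate-cong (λ j → cong (elements B) (Finₚ.cast-is-id refl j))) (toList-elements B)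

-- Signs of Cauchy reals

module _ where
  open import Data.Rational.Base using (_+_; _*_; _-_; -_; _<_; _≤_) renaming (∣_∣ to abs)
  open +-*-Solver

  Eventually : (ℕ → Set) → Set
  Eventually P = ∃[ N ] ∀ i → N ℕ.≤ i → P i

  eventually-map : ∀ {P Q : ℕ → Set} → (∀ i → P i → Q i) → Eventually P → Eventually Q
  eventually-map f (N , p) = N , λ i N≤i → f i (p i N≤i)

  eventually-× : ∀ {P Q : ℕ → Set} → Eventually P → Eventually Q → Eventually (λ i → P i × Q i)
  eventually-× (N , p) (M , q) = N ℕ.⊔ M , λ i h →
    p i (ℕₚ.m⊔n≤o⇒m≤o N M h) , q i (ℕₚ.m⊔n≤o⇒n≤o N M h)

  eventually-absurd : ¬ Eventually (λ _ → ⊥)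
  eventually-absurd (N , p) = p N ℕₚ.≤-refl

  neg-involutive : ∀ x → - (- x) ≡ x
  neg-involutive = solve 1 (λ a → :- (:- a) := a) refl

  x≤∣x∣ : ∀ x → x ≤ abs x
  x≤∣x∣ x with ℚₚ.∣p∣≡p∨∣p∣≡-p x
  ... | inj₁ e = ℚₚ.≤-reflexive (sym e)
  ... | inj₂ e = ℚₚ.≤-trans x≤0 (ℚₚ.0≤∣p∣ x)
    where
    x≤0 : x ≤ 0ℚ
    x≤0 = subst (_≤ 0ℚ) (neg-involutive x) (ℚₚ.neg-antimono-≤ (subst (0ℚ ≤_) e (ℚₚ.0≤∣p∣ x)))

  -∣x∣≤x : ∀ x → - abs x ≤ x
  -∣x∣≤x x = subst (- abs x ≤_) (neg-involutive x)
    (ℚₚ.neg-antimono-≤ (subst (- x ≤_) (ℚₚ.∣-p∣≡∣p∣ x) (x≤∣x∣ (- x))))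

  ∣x∣<ε : ∀ {x ε} → - ε < x → x < ε → abs x < ε
  ∣x∣<ε {x} {ε} -ε<x x<ε with ℚₚ.∣p∣≡p∨∣p∣≡-p x
  ... | inj₁ e = subst (_< ε) (sym e) x<ε
  ... | inj₂ e = subst (_< ε) (sym e) (subst (- x <_) (neg-involutive ε) (ℚₚ.neg-antimono-< -ε<x))

  *-pos : ∀ x y → 0ℚ < x → 0ℚ < y → 0ℚ < x * y
  *-pos x y 0<x 0<y = ℚₚ.positive⁻¹ _ {{ℚₚ.pos*pos⇒pos x {{ℚ.positive 0<x}} y {{ℚ.positive 0<y}}}}

  half-pos : ∀ x → 0ℚ < x → 0ℚ < ½ * x
  half-pos x = *-pos ½ x (ℚₚ.positive⁻¹ ½)

  -- Being null in Defs reads ∣ x i - 0 ∣ < ε; here the - 0 is removed.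
  Null : (ℕ → ℚ) → Set
  Null x = ∀ ε → 0ℚ < ε → Eventually (λ i → abs (x i) < ε)

  ≈0⇒null : ∀ x → x ≈ 0ℝ → Null (seq x)
  ≈0⇒null x x≈0 ε 0<ε =
    eventually-map (λ i → subst (λ t → abs t < ε) (ℚₚ.+-identityʳ (seq x i))) (x≈0 ε 0<ε)

  null⇒≈0 : ∀ x → Null (seq x) → x ≈ 0ℝ
  null⇒≈0 x p ε 0<ε =
    eventually-map (λ i → subst (λ t → abs t < ε) (sym (ℚₚ.+-identityʳ (seq x i)))) (p ε 0<ε)

  bounded : ∀ x → ∃[ K ] 0ℚ < K × Eventually (λ i → abs (seq x i) ≤ K)
  bounded x with cauchy x 1ℚ (ℚₚ.positive⁻¹ 1ℚ)
  ... | N , p = 1ℚ + abs (seq x N) , 0<K , N , λ i N≤i → begin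
      abs (seq x i)
        ≡⟨ cong abs (solve 2 (λ a b → a := (a :- b) :+ b) refl (seq x i) (seq x N)) ⟩
      abs ((seq x i - seq x N) + seq x N)
        ≤⟨ ℚₚ.∣p+q∣≤∣p∣+∣q∣ (seq x i - seq x N) (seq x N) ⟩
      abs (seq x i - seq x N) + abs (seq x N)
        ≤⟨ ℚₚ.+-monoˡ-≤ (abs (seq x N)) (ℚₚ.<⇒≤ (p i N N≤i ℕₚ.≤-refl)) ⟩
      1ℚ + abs (seq x N) ∎
    where
    open ℚₚ.≤-Reasoning
    0<K : 0ℚ < 1ℚ + abs (seq x N)
    0<K = ℚₚ.+-mono-<-≤ (ℚₚ.positive⁻¹ 1ℚ) (ℚₚ.0≤∣p∣ (seq x N))

  null-* : ∀ x y → Null (seq x) → Null (λ i → seq x i * seq y i)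
  null-* x y x-null ε 0<ε = scaled (bounded y)
    where
    open ℚₚ.≤-Reasoning
    step : ∀ K δ i → 0ℚ < K → δ * K ≡ ε → abs (seq x i) < δ → abs (seq y i) ≤ K →
      abs (seq x i * seq y i) < ε
    step K δ i 0<K δK≡ε x<δ y≤K = begin-strict
      abs (seq x i * seq y i)
        ≡⟨ ℚₚ.∣p*q∣≡∣p∣*∣q∣ (seq x i) (seq y i) ⟩
      abs (seq x i) * abs (seq y i)
        ≤⟨ ℚₚ.*-monoˡ-≤-nonNeg (abs (seq x i)) {{ℚₚ.∣-∣-nonNeg (seq x i)}} y≤K ⟩
      abs (seq x i) * K
        <⟨ ℚₚ.*-monoˡ-<-pos K {{ℚ.positive 0<K}} x<δ ⟩
      δ * K
        ≡⟨ δK≡ε ⟩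
      ε ∎
    scaled : (∃[ K ] 0ℚ < K × Eventually (λ i → abs (seq y i) ≤ K)) →
      Eventually (λ i → abs (seq x i * seq y i) < ε)
    scaled (K , 0<K , y≤K) =
      eventually-map (λ i (x<δ , y≤K) → step K δ i 0<K δK≡ε x<δ y≤K)
        (eventually-× (x-null δ 0<δ) y≤K)
      where
      instance
        K>0 : ℚ.Positive K
        K>0 = ℚ.positive 0<K
        K≢0 : ℚ.NonZero K
        K≢0 = ℚₚ.pos⇒nonZero K
      δ : ℚ
      δ = ε * ℚ.1/ K
      0<δ : 0ℚ < δ
      0<δ = *-pos ε (ℚ.1/ K) 0<ε (ℚₚ.positive⁻¹ (ℚ.1/ K) {{ℚₚ.1/pos⇒pos K}})
      δK≡ε : δ * K ≡ ε
      δK≡ε = trans (ℚₚ.*-assoc ε (ℚ.1/ K) K)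
                   (trans (cong (ε *_) (ℚₚ.*-inverseˡ K)) (ℚₚ.*-identityʳ ε))

  BoundedBelow : ℝ → Set
  BoundedBelow x = ∃[ δ ] 0ℚ < δ × Eventually (λ i → δ ≤ seq x i)

  -- A Cauchy sequence decides, at a late index, between x < ε and x bounded
  -- below; this gives tightness without excluded middle.
  ¬boundedBelow⇒null : ∀ x → 0ℝ ≤ᴿ x → ¬ BoundedBelow x → Null (seq x)
  ¬boundedBelow⇒null x 0≤x ¬bb ε 0<ε with cauchy x (½ * (½ * ε)) (half-pos (½ * ε) (half-pos ε 0<ε))
  -- Threshold ε/2 and Cauchy tolerance ε/4: later values are at least ε/4 in the first case and
  -- below 3ε/4 in the second.
  ... | N , close with ½ * ε ℚₚ.≤? seq x N
  ... | yes ½ε≤xN = ⊥-elim (¬bb (½ * (½ * ε) , half-pos (½ * ε) (half-pos ε 0<ε) , N , λ i N≤i → begin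
      ½ * (½ * ε)
        ≡⟨ solve 1 (λ e → con ½ :* (con ½ :* e) := con ½ :* e :- con ½ :* (con ½ :* e)) refl ε ⟩
      ½ * ε - ½ * (½ * ε)
        ≤⟨ ℚₚ.+-mono-≤ ½ε≤xN (ℚₚ.neg-antimono-≤ (ℚₚ.≤-trans (x≤∣x∣ (seq x N - seq x i))
                                                     (ℚₚ.<⇒≤ (close N i ℕₚ.≤-refl N≤i)))) ⟩
      seq x N - (seq x N - seq x i)
        ≡⟨ solve 2 (λ a b → a :- (a :- b) := b) refl (seq x N) (seq x i) ⟩
      seq x i ∎))
    where open ℚₚ.≤-Reasoning
  ... | no ½ε≰xN = eventually-map (λ i (0<x+ε , x<ε) → ∣x∣<ε (lower i 0<x+ε) x<ε)
                     (eventually-× (0≤x ε 0<ε) (N , upper))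
    where
    open ℚₚ.≤-Reasoning
    lower : ∀ i → 0ℚ < seq x i + ε → - ε < seq x i
    lower i 0<x+ε = begin-strict
      - ε               ≡⟨ ℚₚ.+-identityˡ (- ε) ⟨
      0ℚ - ε            <⟨ ℚₚ.+-monoˡ-< (- ε) 0<x+ε ⟩
      seq x i + ε - ε   ≡⟨ solve 2 (λ a e → a :+ e :- e := a) refl (seq x i) ε ⟩
      seq x i           ∎
    upper : ∀ i → N ℕ.≤ i → seq x i < ε
    upper i N≤i = begin-strict
      seq x i
        ≡⟨ solve 2 (λ a b → a := b :+ (a :- b)) refl (seq x i) (seq x N) ⟩
      seq x N + (seq x i - seq x N)
        <⟨ ℚₚ.+-mono-<-≤ (ℚₚ.≰⇒> ½ε≰xN)
             (ℚₚ.≤-trans (x≤∣x∣ _) (ℚₚ.<⇒≤ (close i N N≤i ℕₚ.≤-refl))) ⟩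
      ½ * ε + ½ * (½ * ε)
        <⟨ ℚₚ.+-monoʳ-< (½ * ε) (ℚₚ.*-monoʳ-<-pos ½ ½ε<ε) ⟩
      ½ * ε + ½ * ε
        ≡⟨ solve 1 (λ e → con ½ :* e :+ con ½ :* e := e) refl ε ⟩
      ε ∎
      where
      ½ε<ε : ½ * ε < ε
      ½ε<ε = begin-strict
        ½ * ε           ≡⟨ ℚₚ.+-identityʳ (½ * ε) ⟨
        ½ * ε + 0ℚ      <⟨ ℚₚ.+-monoʳ-< (½ * ε) (half-pos ε 0<ε) ⟩
        ½ * ε + ½ * ε   ≡⟨ solve 1 (λ e → con ½ :* e :+ con ½ :* e := e) refl ε ⟩
        ε               ∎

  *-mono-≤-pos : ∀ a b x y → 0ℚ < a → 0ℚ < b → a ≤ x → b ≤ y → a * b ≤ x * y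
  *-mono-≤-pos a b x y 0<a 0<b a≤x b≤y = ℚₚ.≤-trans
    (ℚₚ.*-monoˡ-≤-nonNeg a {{ℚ.nonNegative (ℚₚ.<⇒≤ 0<a)}} b≤y)
    (ℚₚ.*-monoʳ-≤-nonNeg y {{ℚ.nonNegative (ℚₚ.≤-trans (ℚₚ.<⇒≤ 0<b) b≤y)}} a≤x)

  -- A null factor makes the product null; otherwise both factors are bounded below and the product
  -- is eventually positive. Which case holds cannot be decided, hence the double negation.
  nonneg-* : ∀ x y → 0ℝ ≤ᴿ x → 0ℝ ≤ᴿ y → ∀ ε → 0ℚ < ε →
    ¬ ¬ Eventually (λ i → - ε < seq x i * seq y i)
  nonneg-* x y 0≤x 0≤y ε 0<ε k =
    null-x (¬boundedBelow⇒null x 0≤x λ bbx →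
    null-y (¬boundedBelow⇒null y 0≤y λ bby →
    k (both bbx bby)))
    where
    below : Eventually (λ i → abs (seq x i * seq y i) < ε) → Eventually (λ i → - ε < seq x i * seq y i)
    below = eventually-map λ i xy<ε → ℚₚ.<-≤-trans (ℚₚ.neg-antimono-< xy<ε) (-∣x∣≤x _)
    null-x : ¬ Null (seq x)
    null-x x-null = k (below (null-* x y x-null ε 0<ε))
    null-y : ¬ Null (seq y)
    null-y y-null = k (below (eventually-map
      (λ i → subst (λ t → abs t < ε) (ℚₚ.*-comm (seq y i) (seq x i))) (null-* y x y-null ε 0<ε)))
    both : BoundedBelow x → BoundedBelow y → Eventually (λ i → - ε < seq x i * seq y i)
    both (a , 0<a , a≤x) (b , 0<b , b≤y) = eventually-map
      (λ i (a≤xi , b≤yi) → ℚₚ.<-≤-trans (ℚₚ.<-trans (ℚₚ.neg-antimono-< 0<ε) (*-pos a b 0<a 0<b))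
                                        (*-mono-≤-pos a b (seq x i) (seq y i) 0<a 0<b a≤xi b≤yi))
      (eventually-× a≤x b≤y)

  -- With positive eventual lower bounds `a` of `r` and `b` of `s`, the right side is eventually
  -- above ab/2, whereas `p` null puts the left side below it. Not being null yields `a` and `b`
  -- only up to double negation, enough for a negated conclusion.
  nonzero-product-sum : ∀ p q r s t u → 0ℝ ≤ᴿ r → 0ℝ ≤ᴿ s → 0ℝ ≤ᴿ t → 0ℝ ≤ᴿ u →
    (∀ i → seq p i * seq q i ≡ seq r i * seq s i + seq t i * seq u i) →
    ¬ r ≈ 0ℝ → ¬ s ≈ 0ℝ → ¬ p ≈ 0ℝ
  nonzero-product-sum p q r s t u 0≤r 0≤s 0≤t 0≤u pq≡rs+tu r≉0 s≉0 p≈0 =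
    r≉0 (null⇒≈0 r (¬boundedBelow⇒null r 0≤r λ (a , 0<a , a≤r) →
    s≉0 (null⇒≈0 s (¬boundedBelow⇒null s 0≤s λ (b , 0<b , b≤s) →
    let 0<c = half-pos (a * b) (*-pos a b 0<a 0<b) in
    nonneg-* t u 0≤t 0≤u (½ * (a * b)) 0<c λ tu>-c →
    eventually-absurd (eventually-map
      (λ i ((a≤ri , b≤si) , (tu>-c , pq<c)) → ℚₚ.<-irrefl refl (begin-strict
        ½ * (a * b)
          ≡⟨ solve 1 (λ c → con ½ :* c := c :- con ½ :* c) refl (a * b) ⟩
        a * b - ½ * (a * b)
          <⟨ ℚₚ.+-mono-≤-< (*-mono-≤-pos a b (seq r i) (seq s i) 0<a 0<b a≤ri b≤si) tu>-c ⟩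
        seq r i * seq s i + seq t i * seq u i
          ≡⟨ pq≡rs+tu i ⟨
        seq p i * seq q i
          ≤⟨ x≤∣x∣ _ ⟩
        abs (seq p i * seq q i)
          <⟨ pq<c ⟩
        ½ * (a * b) ∎))
      (eventually-× (eventually-× a≤r b≤s)
        (eventually-× tu>-c (null-* p q (≈0⇒null p p≈0) _ 0<c))))))))
    where open ℚₚ.≤-Reasoning

-- Finite subsets

open import Data.Fin.Subset using (_-_)

module _ where

  private variable
    n : ℕ
    x y : Fin n
    S T : Subset n

  ∈-⊕ˡ : x ∈ S → x ∈ S ⊕ y
  ∈-⊕ˡ = x∈p∪q⁺ ∘ inj₁

  ∈-⊕ʳ : y ∈ S ⊕ y
  ∈-⊕ʳ {y = y} = x∈p∪q⁺ (inj₂ (x∈⁅x⁆ y))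

  ∈-⊕⁻ : x ∈ S ⊕ y → x ∈ S ⊎ x ≡ y
  ∈-⊕⁻ {S = S} {y = y} x∈ = [ inj₁ , inj₂ ∘ x∈⁅y⁆⇒x≡y y ]′ (x∈p∪q⁻ S ⁅ y ⁆ x∈)

  ∉-⊕ : x ∉ S → x ≢ y → x ∉ S ⊕ y
  ∉-⊕ x∉S x≢y = [ x∉S , x≢y ]′ ∘ ∈-⊕⁻

  ⊕-⊆ : S ⊆ T → y ∈ T → S ⊕ y ⊆ T
  ⊕-⊆ S⊆T y∈T = [ S⊆T , (λ { refl → y∈T }) ]′ ∘ ∈-⊕⁻

  ⊕-monoˡ : S ⊆ T → S ⊕ y ⊆ T ⊕ y
  ⊕-monoˡ S⊆T = ⊕-⊆ (∈-⊕ˡ ∘ S⊆T) ∈-⊕ʳ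

  x∉p-x : ∀ (p : Subset n) x → x ∉ p - x
  x∉p-x (_ ∷ p) (suc x) (Vec.there x∈) = x∉p-x p x x∈

  ∈-remove⁻ : x ∈ S - y → x ∈ S × x ≢ y
  ∈-remove⁻ {S = S} {y = y} x∈ = p─q⊆p S ⁅ y ⁆ x∈ , λ { refl → x∉p-x S y x∈ }

  remove-⊕ : y ∈ S → S - y ⊕ y ≡ S
  remove-⊕ {y = y} {S = S} y∈S = ⊆-antisym (⊕-⊆ (proj₁ ∘ ∈-remove⁻) y∈S) λ {x} x∈S → split x x∈S (x Finₚ.≟ y)
    where
    split : ∀ x → x ∈ S → _ → x ∈ S - y ⊕ y
    split x x∈S (yes refl) = ∈-⊕ʳ
    split x x∈S (no x≢y)   = ∈-⊕ˡ (x∈p∧x≢y⇒x∈p-y x∈S x≢y)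

  ∣⊕∣ : ∀ (S : Subset n) {x} → x ∉ S → ∣ S ⊕ x ∣ ≡ ℕ.suc ∣ S ∣
  ∣⊕∣ (inside  ∷ S) {zero}  x∉S = ⊥-elim (x∉S Vec.here)
  ∣⊕∣ (outside ∷ S) {zero}  x∉S = cong (ℕ.suc ∘ ∣_∣) (∪-identityʳ S)
  ∣⊕∣ (inside  ∷ S) {suc x} x∉S = cong ℕ.suc (∣⊕∣ S (drop-not-there x∉S))
  ∣⊕∣ (outside ∷ S) {suc x} x∉S = ∣⊕∣ S (drop-not-there x∉S)

  ∣⊕∣≤ : ∀ (S : Subset n) x → ∣ S ⊕ x ∣ ℕ.≤ ℕ.suc ∣ S ∣
  ∣⊕∣≤ S x with x ∈? S
  ... | yes x∈S = ℕₚ.m≤n⇒m≤1+n (p⊆q⇒∣p∣≤∣q∣ (⊕-⊆ id x∈S))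
  ... | no  x∉S = ℕₚ.≤-reflexive (∣⊕∣ S x∉S)

  ∣∪∣+∣∩∣ : ∀ (p q : Subset n) → ∣ p ∪ q ∣ ℕ.+ ∣ p ∩ q ∣ ≡ ∣ p ∣ ℕ.+ ∣ q ∣
  ∣∪∣+∣∩∣ []            []            = refl
  ∣∪∣+∣∩∣ (inside  ∷ p) (inside  ∷ q) = cong ℕ.suc
    (trans (ℕₚ.+-suc _ _) (trans (cong ℕ.suc (∣∪∣+∣∩∣ p q)) (sym (ℕₚ.+-suc _ _))))
  ∣∪∣+∣∩∣ (inside  ∷ p) (outside ∷ q) = cong ℕ.suc (∣∪∣+∣∩∣ p q)
  ∣∪∣+∣∩∣ (outside ∷ p) (inside  ∷ q) = trans (cong ℕ.suc (∣∪∣+∣∩∣ p q)) (sym (ℕₚ.+-suc _ _))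
  ∣∪∣+∣∩∣ (outside ∷ p) (outside ∷ q) = ∣∪∣+∣∩∣ p q

  ⊆∧∣≥∣⇒≡ : S ⊆ T → ∣ T ∣ ℕ.≤ ∣ S ∣ → S ≡ T
  ⊆∧∣≥∣⇒≡ {S = S} S⊆T ∣T∣≤∣S∣ = ⊆-antisym S⊆T λ {x} x∈T → back x x∈T (x ∈? S)
    where
    back : ∀ x → x ∈ _ → _ → x ∈ S
    back x x∈T (yes x∈S) = x∈S
    back x x∈T (no x∉S)  = ⊥-elim (ℕₚ.<⇒≱ (p⊂q⇒∣p∣<∣q∣ (S⊆T , x , x∈T , x∉S)) ∣T∣≤∣S∣)

∈-subsets : ∀ {n} (S : Subset n) → S List∈.∈ subsets n
∈-subsets []                      = here refl
∈-subsets {ℕ.suc n} (outside ∷ S) = List∈ₚ.∈-++⁺ˡ (List∈ₚ.∈-map⁺ (outside ∷_) (∈-subsets S))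
∈-subsets {ℕ.suc n} (inside  ∷ S) =
  List∈ₚ.∈-++⁺ʳ (List.map (outside ∷_) (subsets n)) (List∈ₚ.∈-map⁺ (inside ∷_) (∈-subsets S))

-- Noncrossing bases from nonnegative minors

module _ {n : ℕ} (M : Matroid n) where
  open Matroid M

  -- What the Plücker relation leaves visible in the bases: if the two sides in some opposite pair
  -- of the quadrilateral `a`, `b`, `c`, `d` are both bases modulo `S`, so are both diagonals.
  Noncrossing : Set
  Noncrossing = ∀ S {a b c d} → a Fin.< b → b Fin.< c → c Fin.< d →
    a ∉ S → b ∉ S → c ∉ S → d ∉ S →
    (Basis (S ⊕ a ⊕ b) × Basis (S ⊕ c ⊕ d)) ⊎ (Basis (S ⊕ a ⊕ d) × Basis (S ⊕ b ⊕ c)) →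
    Basis (S ⊕ a ⊕ c) × Basis (S ⊕ b ⊕ d)

  module _ {r : ℕ} (positroid : IsPositroidOfRank M r) where
    private
      A       = proj₁ positroid
      minor≥0 = proj₁ (proj₂ (proj₂ positroid))
      basis⇔  = proj₂ (proj₂ (proj₂ positroid))

    ∣basis∣ : ∀ {B} → Basis B → ∣ B ∣ ≡ r
    ∣basis∣ {B} = proj₁ ∘ Equivalence.to (basis⇔ B)

    noncrossing : Noncrossing
    noncrossing S {a} {b} {c} {d} a<b b<c c<d a∉S b∉S c∉S d∉S = go
      where
      Δ : ∀ {u v} → ∣ S ⊕ u ⊕ v ∣ ≡ r → ℝ
      Δ {u} {v} = minor A (S ⊕ u ⊕ v)
      a<c = ℕₚ.<-trans a<b b<c
      b<d = ℕₚ.<-trans b<c c<d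
      a<d = ℕₚ.<-trans a<c c<d

      ∣⊕⊕∣ : ∀ {u v} → u Fin.< v → u ∉ S → v ∉ S → ∣ S ⊕ u ⊕ v ∣ ≡ ℕ.suc (ℕ.suc ∣ S ∣)
      ∣⊕⊕∣ {u} {v} u<v u∉S v∉S =
        trans (∣⊕∣ (S ⊕ u) (∉-⊕ v∉S (≢-sym (Finₚ.<⇒≢ u<v)))) (cong ℕ.suc (∣⊕∣ S u∉S))

      nonzero : ∀ {u v} (e : ∣ S ⊕ u ⊕ v ∣ ≡ r) → Basis (S ⊕ u ⊕ v) → ¬ Δ e ≈ 0ℝ
      nonzero {u} {v} e b with Equivalence.to (basis⇔ (S ⊕ u ⊕ v)) b
      ... | e′ , Δ≉0 = subst (λ e → ¬ Δ e ≈ 0ℝ) (ℕₚ.≡-irrelevant e′ e) Δ≉0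

      module _ (2+∣S∣≡r : ℕ.suc (ℕ.suc ∣ S ∣) ≡ r) where
        size : ∀ {u v} → u Fin.< v → u ∉ S → v ∉ S → ∣ S ⊕ u ⊕ v ∣ ≡ r
        size u<v u∉S v∉S = trans (∣⊕⊕∣ u<v u∉S v∉S) 2+∣S∣≡r

        ab = size a<b a∉S b∉S
        cd = size c<d c∉S d∉S
        ad = size a<d a∉S d∉S
        bc = size b<c b∉S c∉S
        ac = size a<c a∉S c∉S
        bd = size b<d b∉S d∉S

        open import Data.Rational.Base using (_+_; _*_)
        import Data.Rational.Properties as ℚₚ
        plücker : ∀ i → seq (Δ ac) i * seq (Δ bd) i
                      ≡ seq (Δ ab) i * seq (Δ cd) i + seq (Δ ad) i * seq (Δ bc) i
        plücker i = trans (cong₂ _*_ (Δ-form ac) (Δ-form bd))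
          (trans (sorted-three-term-plücker (rowsAt A i) S a<b b<c c<d a∉S b∉S c∉S d∉S)
                 (sym (cong₂ _+_ (cong₂ _*_ (Δ-form ab) (Δ-form cd)) (cong₂ _*_ (Δ-form ad) (Δ-form bc)))))
          where
          Δ-form : ∀ {u v} (e : ∣ S ⊕ u ⊕ v ∣ ≡ r) → seq (Δ e) i ≡ minorForm (rowsAt A i) (toList (S ⊕ u ⊕ v))
          Δ-form {u} {v} = seq-minor i A (S ⊕ u ⊕ v)

        swap-* : ∀ i → seq (Δ bd) i * seq (Δ ac) i ≡ seq (Δ ac) i * seq (Δ bd) i
        swap-* i = ℚₚ.*-comm (seq (Δ bd) i) (seq (Δ ac) i)

        swap-+ : ∀ i → seq (Δ ab) i * seq (Δ cd) i + seq (Δ ad) i * seq (Δ bc) i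
                     ≡ seq (Δ ad) i * seq (Δ bc) i + seq (Δ ab) i * seq (Δ cd) i
        swap-+ i = ℚₚ.+-comm (seq (Δ ab) i * seq (Δ cd) i) (seq (Δ ad) i * seq (Δ bc) i)

        Δ≥0 : ∀ {u v} (e : ∣ S ⊕ u ⊕ v ∣ ≡ r) → 0ℝ ≤ᴿ Δ e
        Δ≥0 = minor≥0 _

        basis : ∀ {u v} (e : ∣ S ⊕ u ⊕ v ∣ ≡ r) → ¬ Δ e ≈ 0ℝ → Basis (S ⊕ u ⊕ v)
        basis e Δ≉0 = Equivalence.from (basis⇔ _) (e , Δ≉0)

        from-ab-cd : Basis (S ⊕ a ⊕ b) → Basis (S ⊕ c ⊕ d) → Basis (S ⊕ a ⊕ c) × Basis (S ⊕ b ⊕ d)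
        from-ab-cd Bab Bcd =
            basis ac (nonzero-product-sum (Δ ac) (Δ bd) (Δ ab) (Δ cd) (Δ ad) (Δ bc)
              (Δ≥0 ab) (Δ≥0 cd) (Δ≥0 ad) (Δ≥0 bc) plücker (nonzero ab Bab) (nonzero cd Bcd))
          , basis bd (nonzero-product-sum (Δ bd) (Δ ac) (Δ ab) (Δ cd) (Δ ad) (Δ bc)
              (Δ≥0 ab) (Δ≥0 cd) (Δ≥0 ad) (Δ≥0 bc) (λ i → trans (swap-* i) (plücker i))
              (nonzero ab Bab) (nonzero cd Bcd))

        from-ad-bc : Basis (S ⊕ a ⊕ d) → Basis (S ⊕ b ⊕ c) → Basis (S ⊕ a ⊕ c) × Basis (S ⊕ b ⊕ d)
        from-ad-bc Bad Bbc =
            basis ac (nonzero-product-sum (Δ ac) (Δ bd) (Δ ad) (Δ bc) (Δ ab) (Δ cd)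
              (Δ≥0 ad) (Δ≥0 bc) (Δ≥0 ab) (Δ≥0 cd) (λ i → trans (plücker i) (swap-+ i))
              (nonzero ad Bad) (nonzero bc Bbc))
          , basis bd (nonzero-product-sum (Δ bd) (Δ ac) (Δ ad) (Δ bc) (Δ ab) (Δ cd)
              (Δ≥0 ad) (Δ≥0 bc) (Δ≥0 ab) (Δ≥0 cd)
              (λ i → trans (swap-* i) (trans (plücker i) (swap-+ i)))
              (nonzero ad Bad) (nonzero bc Bbc))

      go : _ → _
      -- The size of one given basis determines that of `S`, so all six pairs index maximal minors.
      go (inj₁ (Bab , Bcd)) = from-ab-cd (trans (sym (∣⊕⊕∣ a<b a∉S b∉S)) (∣basis∣ Bab)) Bab Bcd
      go (inj₂ (Bad , Bbc)) = from-ad-bc (trans (sym (∣⊕⊕∣ a<d a∉S d∉S)) (∣basis∣ Bad)) Bad Bbc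

-- Rank and closure

module _ {n : ℕ} (M : Matroid n) where
  open Matroid M

  private variable
    x y : Fin n
    S T : Subset n

  private
    Indep : Subset n → Set
    Indep = Independent M

    r : Subset n → ℕ
    r = rk M

  -- Membership of `x` in the closure of `A`. Since rank is monotone the inequality amounts to
  -- equality, and it is decidable.
  Spans : Subset n → Fin n → Set
  Spans A x = r (A ⊕ x) ℕ.≤ r A

  indep-⊆ : S ⊆ T → Indep T → Indep S
  indep-⊆ S⊆T (B , basis , T⊆B) = B , basis , T⊆B ∘ S⊆T

  ∣indep∣≤rk : Indep S → S ⊆ T → ∣ S ∣ ℕ.≤ r T
  ∣indep∣≤rk {S = S} {T = T} indep S⊆T = All.lookup (xs≤max 0 _)
    (List∈ₚ.∈-map⁺ ∣_∣ (List∈ₚ.∈-filter⁺ (λ I → independent? M I ×-dec (I ⊆? T)) (∈-subsets S) (indep , S⊆T)))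

  rk-attained : ∀ T → ∃[ I ] Indep I × I ⊆ T × ∣ I ∣ ≡ r T
  rk-attained T
    with argmax-sel id 0 (List.map ∣_∣ (List.filter (λ I → independent? M I ×-dec (I ⊆? T)) (subsets n)))
  -- The default value 0 of `max` is attained by the empty set, which lies in the basis supplied by
  -- `nonempty`.
  ... | inj₁ rk≡0 = ∅ , (proj₁ nonempty , proj₂ nonempty , ⊥-elim ∘ ∉⊥) , ⊥-elim ∘ ∉⊥
                  , trans (∣⊥∣≡0 n) (sym rk≡0)
  ... | inj₂ rk∈ with List∈ₚ.∈-map⁻ ∣_∣ rk∈
  ... | I , I∈ , rk≡∣I∣ with List∈ₚ.∈-filter⁻ (λ I → independent? M I ×-dec (I ⊆? T)) {xs = subsets n} I∈
  ... | _ , indep , I⊆T = I , indep , I⊆T , sym rk≡∣I∣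

  rk-mono : S ⊆ T → r S ℕ.≤ r T
  rk-mono {S = S} S⊆T with rk-attained S
  ... | I , indep , I⊆S , ∣I∣≡rkS = subst (ℕ._≤ r _) ∣I∣≡rkS (∣indep∣≤rk indep (S⊆T ∘ I⊆S))

  rk-⊕≤ : ∀ T x → r (T ⊕ x) ℕ.≤ ℕ.suc (r T)
  rk-⊕≤ T x with rk-attained (T ⊕ x)
  ... | I , indep , I⊆ , ∣I∣≡ = begin
    r (T ⊕ x)          ≡⟨ ∣I∣≡ ⟨
    ∣ I ∣              ≤⟨ p⊆q⇒∣p∣≤∣q∣ I⊆I-x⊕x ⟩
    ∣ I - x ⊕ x ∣      ≤⟨ ∣⊕∣≤ (I - x) x ⟩
    ℕ.suc ∣ I - x ∣    ≤⟨ ℕ.s≤s (∣indep∣≤rk (indep-⊆ (proj₁ ∘ ∈-remove⁻) indep) I-x⊆T) ⟩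
    ℕ.suc (r T)        ∎
    where
    open ℕₚ.≤-Reasoning
    I-x⊆T : I - x ⊆ T
    I-x⊆T z∈ with ∈-remove⁻ z∈
    ... | z∈I , z≢x = [ id , ⊥-elim ∘ z≢x ]′ (∈-⊕⁻ (I⊆ z∈I))
    I⊆I-x⊕x : I ⊆ I - x ⊕ x
    I⊆I-x⊕x {z} z∈I with z Finₚ.≟ x
    ... | yes refl = ∈-⊕ʳ
    ... | no z≢x   = ∈-⊕ˡ (x∈p∧x≢y⇒x∈p-y z∈I z≢x)

  ∈⇒spans : x ∈ S → Spans S x
  ∈⇒spans x∈S = rk-mono (⊕-⊆ id x∈S)

  -- As `x` adds nothing to `S ⊕ y`, the rank of `S ⊕ x ⊕ y` is at most one above that of `S`, a
  -- value that `S ⊕ x` already reaches.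
  spans-exchange : Spans (S ⊕ y) x → ¬ Spans S x → Spans (S ⊕ x) y
  spans-exchange {S = S} {y = y} {x = x} spans ¬spans = begin
    r (S ⊕ x ⊕ y)  ≡⟨ cong r (⊕-comm S x y) ⟩
    r (S ⊕ y ⊕ x)  ≤⟨ spans ⟩
    r (S ⊕ y)      ≤⟨ rk-⊕≤ S y ⟩
    ℕ.suc (r S)    ≤⟨ ℕₚ.≰⇒> ¬spans ⟩
    r (S ⊕ x)      ∎
    where open ℕₚ.≤-Reasoning

  spans-cancel : Spans (S ⊕ y) x → Spans S y → Spans S x
  spans-cancel {S = S} {y = y} {x = x} spans-x spans-y = begin
    r (S ⊕ x)      ≤⟨ rk-mono (⊕-monoˡ ∈-⊕ˡ) ⟩
    r (S ⊕ y ⊕ x)  ≤⟨ spans-x ⟩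
    r (S ⊕ y)      ≤⟨ spans-y ⟩
    r S            ∎
    where open ℕₚ.≤-Reasoning

  -- In a basis containing `I`, elements outside `I ∪ B` are exchanged one by one for elements of
  -- `B`. `I` is never touched, and `excess` shrinks strictly because the newcomer lies in `B`.
  extend-basis : ∀ {I B} → Indep I → Basis B → ∃[ B′ ] Basis B′ × I ⊆ B′ × B′ ⊆ I ∪ B
  extend-basis {I} {B} (B₀ , basis₀ , I⊆B₀) basis = loop B₀ basis₀ I⊆B₀ (⊂-wellFounded _)
    where
    excess : Subset n → Subset n
    excess C = C ∩ ∁ (I ∪ B)
    loop : ∀ C → Basis C → I ⊆ C → Acc _⊂_ (excess C) → ∃[ B′ ] Basis B′ × I ⊆ B′ × B′ ⊆ I ∪ B
    loop C basisC I⊆C (acc rec) with nonempty? (excess C)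
    ... | no  empty = C , basisC , I⊆C , λ {z} z∈C → inside? z∈C (z ∈? (I ∪ B))
      where
      inside? : ∀ {z} → z ∈ C → _ → z ∈ I ∪ B
      inside? z∈C (yes z∈) = z∈
      inside? z∈C (no z∉)  = ⊥-elim (empty (_ , x∈p∩q⁺ (z∈C , x∉p⇒x∈∁p z∉)))
    ... | yes (z , z∈) with x∈p∩q⁻ C (∁ (I ∪ B)) z∈
    ... | z∈C , z∈∁ with exchange basisC basis z∈C (x∈∁p⇒x∉p z∈∁ ∘ x∈p∪q⁺ ∘ inj₂)
    ... | y , y∈B , y∉C , basis′ = loop (C - z ⊕ y) basis′ I⊆ (rec (smaller , z , z∈ , z∉))
      where
      I⊆ : I ⊆ C - z ⊕ y
      I⊆ w∈I = ∈-⊕ˡ (x∈p∧x≢y⇒x∈p-y (I⊆C w∈I) λ { refl → x∈∁p⇒x∉p z∈∁ (x∈p∪q⁺ (inj₁ w∈I)) })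
      smaller : excess (C - z ⊕ y) ⊆ excess C
      smaller w∈ with x∈p∩q⁻ (C - z ⊕ y) (∁ (I ∪ B)) w∈
      ... | w∈⊕ , w∈∁ with ∈-⊕⁻ w∈⊕
      ... | inj₁ w∈C-z = x∈p∩q⁺ (proj₁ (∈-remove⁻ w∈C-z) , w∈∁)
      ... | inj₂ refl  = ⊥-elim (x∈∁p⇒x∉p w∈∁ (x∈p∪q⁺ (inj₂ y∈B)))
      z∉ : z ∉ excess (C - z ⊕ y)
      z∉ w∈ with ∈-⊕⁻ (proj₁ (x∈p∩q⁻ (C - z ⊕ y) (∁ (I ∪ B)) w∈))
      ... | inj₁ z∈C-z = x∉p-x C z z∈C-z
      ... | inj₂ refl  = y∉C z∈C

  module _ {d : ℕ} (∣basis∣≡d : ∀ {B} → Basis B → ∣ B ∣ ≡ d) where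

    -- Let `B` be a basis containing `K`, and `C` one with `I ⊆ C` and `C ⊆ I ∪ B`. If `C` met `K`
    -- only inside `I`, then `C ∪ K ⊆ I ∪ B` and `C ∩ K ⊆ I ∩ B`; as `B` and `C` have equal size,
    -- `K` would be no larger than `I`.
    augment : ∀ {I K} → Indep I → Indep K → ∣ I ∣ ℕ.< ∣ K ∣ → ∃[ k ] k ∈ K × k ∉ I × Indep (I ⊕ k)
    augment {I} {K} indepI (B , basisB , K⊆B) ∣I∣<∣K∣ with extend-basis indepI basisB
    ... | C , basisC , I⊆C , C⊆I∪B with nonempty? (K ∩ C ∩ ∁ I)
    ... | yes (k , k∈) = k , proj₁ k∈K×k∈C∩∁I , x∈∁p⇒x∉p (proj₂ k∈C×k∈∁I)
                       , C , basisC , ⊕-⊆ I⊆C (proj₁ k∈C×k∈∁I)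
      where
      k∈K×k∈C∩∁I = x∈p∩q⁻ K (C ∩ ∁ I) k∈
      k∈C×k∈∁I = x∈p∩q⁻ C (∁ I) (proj₂ k∈K×k∈C∩∁I)
    ... | no empty = ⊥-elim (ℕₚ.<⇒≱ ∣I∣<∣K∣ (ℕₚ.+-cancelˡ-≤ d _ _ (begin
        d ℕ.+ ∣ K ∣                   ≡⟨ cong (ℕ._+ ∣ K ∣) (∣basis∣≡d basisC) ⟨
        ∣ C ∣ ℕ.+ ∣ K ∣               ≡⟨ ∣∪∣+∣∩∣ C K ⟨
        ∣ C ∪ K ∣ ℕ.+ ∣ C ∩ K ∣       ≤⟨ ℕₚ.+-mono-≤ (p⊆q⇒∣p∣≤∣q∣ ∪⊆) (p⊆q⇒∣p∣≤∣q∣ ∩⊆) ⟩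
        ∣ I ∪ B ∣ ℕ.+ ∣ I ∩ B ∣       ≡⟨ ∣∪∣+∣∩∣ I B ⟩
        ∣ I ∣ ℕ.+ ∣ B ∣               ≡⟨ cong (∣ I ∣ ℕ.+_) (∣basis∣≡d basisB) ⟩
        ∣ I ∣ ℕ.+ d                   ≡⟨ ℕₚ.+-comm ∣ I ∣ d ⟩
        d ℕ.+ ∣ I ∣                   ∎)))
      where
      open ℕₚ.≤-Reasoning
      ∪⊆ : C ∪ K ⊆ I ∪ B
      ∪⊆ z∈ = [ C⊆I∪B , x∈p∪q⁺ ∘ inj₂ ∘ K⊆B ]′ (x∈p∪q⁻ C K z∈)
      ∩⊆ : C ∩ K ⊆ I ∩ B
      ∩⊆ {z} z∈ with x∈p∩q⁻ C K z∈ | z ∈? I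
      ... | z∈C , z∈K | yes z∈I = x∈p∩q⁺ (z∈I , K⊆B z∈K)
      ... | z∈C , z∈K | no  z∉I = ⊥-elim (empty (z , x∈p∩q⁺ (z∈K , x∈p∩q⁺ (z∈C , x∉p⇒x∈∁p z∉I))))

    extend-indep : ∀ {I A} → Indep I → I ⊆ A → ∃[ J ] Indep J × I ⊆ J × J ⊆ A × ∣ J ∣ ≡ r A
    extend-indep {I} {A} indepI I⊆A with rk-attained A
    ... | K , indepK , K⊆A , ∣K∣≡rkA with ℕₚ.m≤n⇒∃[o]m+o≡n (∣indep∣≤rk indepI I⊆A)
    ... | k , ∣I∣+k≡rkA = loop k I indepI I⊆A ∣I∣+k≡rkA
      where
      loop : ∀ k I → Indep I → I ⊆ A → ∣ I ∣ ℕ.+ k ≡ r A →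
        ∃[ J ] Indep J × I ⊆ J × J ⊆ A × ∣ J ∣ ≡ r A
      loop ℕ.zero    I indep I⊆A e = I , indep , id , I⊆A , trans (sym (ℕₚ.+-identityʳ ∣ I ∣)) e
      loop (ℕ.suc k) I indep I⊆A e
        with augment indep indepK (subst (∣ I ∣ ℕ.<_) (trans e (sym ∣K∣≡rkA)) (ℕₚ.m<m+n ∣ I ∣ ℕ.z<s))
      ... | x , x∈K , x∉I , indep′
        with loop k (I ⊕ x) indep′ (⊕-⊆ I⊆A (K⊆A x∈K))
               (trans (cong (ℕ._+ k) (∣⊕∣ I x∉I)) (trans (sym (ℕₚ.+-suc ∣ I ∣ k)) e))
      ... | J , indepJ , I⊕x⊆J , rest = J , indepJ , I⊕x⊆J ∘ ∈-⊕ˡ , rest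

    -- An element augmenting `J` inside `F ⊕ y` cannot lie in `F`, where `J` is already largest; so
    -- it is `y`.
    indep-⊕ : ∀ {J F y} → Indep J → J ⊆ F → ∣ J ∣ ≡ r F → ¬ Spans F y → Indep (J ⊕ y)
    indep-⊕ {J} {F} {y} indep J⊆F ∣J∣≡rkF ¬spans with rk-attained (F ⊕ y)
    ... | K , indepK , K⊆ , ∣K∣≡
      with augment indep indepK (subst₂ ℕ._<_ (sym ∣J∣≡rkF) (sym ∣K∣≡) (ℕₚ.≰⇒> ¬spans))
    ... | k , k∈K , k∉J , indep′ with ∈-⊕⁻ (K⊆ k∈K)
    ... | inj₂ refl = indep′
    ... | inj₁ k∈F  = ⊥-elim (ℕₚ.1+n≰n (subst (ℕ._≤ r F) (trans (∣⊕∣ J k∉J) (cong ℕ.suc ∣J∣≡rkF))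
                                              (∣indep∣≤rk indep′ (⊕-⊆ J⊆F k∈F))))

    -- A largest independent set `I` of `S` extends to one, `J`, of `T`. If `T` did not span `x`,
    -- then `J ⊕ x`, and with it `I ⊕ x`, would be independent, too large for the rank of `S ⊕ x`.
    spans-mono : S ⊆ T → Spans S x → Spans T x
    spans-mono {S = S} {T = T} {x = x} S⊆T spans with r (T ⊕ x) ℕₚ.≤? r T
    ... | yes p = p
    ... | no ¬p with rk-attained S
    ... | I , indepI , I⊆S , ∣I∣≡ with extend-indep indepI (S⊆T ∘ I⊆S)
    ... | J , indepJ , I⊆J , J⊆T , ∣J∣≡ = ⊥-elim (ℕₚ.1+n≰n (begin
        ℕ.suc (r S)   ≡⟨ cong ℕ.suc ∣I∣≡ ⟨
        ℕ.suc ∣ I ∣   ≡⟨ ∣⊕∣ I (¬p ∘ ∈⇒spans ∘ S⊆T ∘ I⊆S) ⟨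
        ∣ I ⊕ x ∣     ≤⟨ ∣indep∣≤rk (indep-⊆ (⊕-monoˡ I⊆J) (indep-⊕ indepJ J⊆T ∣J∣≡ ¬p)) (⊕-monoˡ I⊆S) ⟩
        r (S ⊕ x)     ≤⟨ spans ⟩
        r S           ∎))
      where open ℕₚ.≤-Reasoning

    spans-trans : Spans (S ⊕ x) y → ∀ {z} → Spans (S ⊕ z) x → Spans (S ⊕ z) y
    spans-trans spans-y spans-x = spans-cancel (spans-mono (⊕-monoˡ ∈-⊕ˡ) spans-y) spans-x

-- Crossing bases forced by a spanned element

module _ {n : ℕ} (M : Matroid n) where
  open Matroid M

  private
    Indep : Subset n → Set
    Indep = Independent M

    r : Subset n → ℕ
    r = rk M

  CrossingBases : (F : Subset n) (x y i : Fin n) → Set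
  CrossingBases F x y i = ∃[ S ] ∃[ f ] f ∈ F × f ∉ S × y ∉ S × x ∉ S × i ∉ S ×
    Basis (S ⊕ f ⊕ y) × Basis (S ⊕ x ⊕ i) × ¬ Basis (S ⊕ f ⊕ x)

  module _ {d : ℕ} (∣basis∣≡d : ∀ {B} → Matroid.Basis M B → ∣ B ∣ ≡ d) where

    -- I is a basis of F ⊕ x through x, and J = I - x ⊕ f a basis of F.  S is the
    -- rest of a basis B₀ ⊇ J ⊕ y; a basis B₁ with I ⊕ i ⊆ B₁ ⊆ I ⊕ i ∪ B₀ must be
    -- S ⊕ x ⊕ i.
    crossing-bases : ∀ {F x y i} → Indep ⁅ x ⁆ → x ∉ F → Spans M F x →
      ¬ Spans M F y → ¬ Spans M F i → Spans M (F ⊕ y) i → y ≢ i → CrossingBases F x y i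
    crossing-bases {F} {x} {y} {i} indep-x x∉F x∈clF y∉clF i∉clF i∈clFy y≢i
      with extend-indep M ∣basis∣≡d {A = F ⊕ x} indep-x (λ z∈ → x∈p∪q⁺ (inj₂ z∈)) | rk-attained M F
    ... | I , indepI , ⁅x⁆⊆I , I⊆F⊕x , ∣I∣≡ | K , indepK , K⊆F , ∣K∣≡ =
      -- `I - x` is one element short of a basis of `F`; the basis `K` supplies the missing `f`.
      go (augment M ∣basis∣≡d (indep-⊆ M (proj₁ ∘ ∈-remove⁻) indepI) indepK
           (subst (∣ I - x ∣ ℕ.<_) (trans ∣I∣≡rkF (sym ∣K∣≡)) (x∈p⇒∣p-x∣<∣p∣ x∈I)))
      where
      open ℕₚ.≤-Reasoning
      x∈I : x ∈ I
      x∈I = ⁅x⁆⊆I (x∈⁅x⁆ x)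
      ∣I∣≡rkF : ∣ I ∣ ≡ r F
      ∣I∣≡rkF = trans ∣I∣≡ (ℕₚ.≤-antisym x∈clF (rk-mono M ∈-⊕ˡ))
      1+∣I-x∣≡∣I∣ : ℕ.suc ∣ I - x ∣ ≡ ∣ I ∣
      1+∣I-x∣≡∣I∣ = trans (sym (∣⊕∣ (I - x) (x∉p-x I x))) (cong ∣_∣ (remove-⊕ x∈I))
      I-x⊆F : I - x ⊆ F
      I-x⊆F z∈ with ∈-remove⁻ z∈
      ... | z∈I , z≢x = [ id , ⊥-elim ∘ z≢x ]′ (∈-⊕⁻ (I⊆F⊕x z∈I))
      y∉F : y ∉ F
      y∉F = y∉clF ∘ ∈⇒spans M
      x≢y : x ≢ y
      x≢y refl = y∉clF x∈clF
      i∉clFx : ¬ Spans M (F ⊕ x) i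
      i∉clFx i∈clFx = i∉clF (spans-cancel M i∈clFx x∈clF)
      y∉I⊕i : y ∉ I ⊕ i
      y∉I⊕i = ∉-⊕ (∉-⊕ y∉F (≢-sym x≢y) ∘ I⊆F⊕x) y≢i
      indepI⊕i : Indep (I ⊕ i)
      indepI⊕i = indep-⊕ M ∣basis∣≡d indepI I⊆F⊕x ∣I∣≡ i∉clFx
      i∉I : i ∉ I
      i∉I = i∉clFx ∘ ∈⇒spans M ∘ I⊆F⊕x

      go : ∃[ f ] f ∈ K × f ∉ I - x × Indep (I - x ⊕ f) → CrossingBases F x y i
      go (f , f∈K , f∉I-x , indepJ) = found
        (proj₁ B₀-data) (proj₁ (proj₂ B₀-data)) (proj₂ (proj₂ B₀-data))
        (extend-basis M indepI⊕i (proj₁ (proj₂ B₀-data)))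
        where
        J = I - x ⊕ f
        f∈F : f ∈ F
        f∈F = K⊆F f∈K
        f≢x : f ≢ x
        f≢x refl = x∉F f∈F
        f≢y : f ≢ y
        f≢y refl = y∉F f∈F
        ∣J∣≡rkF : ∣ J ∣ ≡ r F
        ∣J∣≡rkF = trans (∣⊕∣ (I - x) f∉I-x) (trans 1+∣I-x∣≡∣I∣ ∣I∣≡rkF)
        J⊆F : J ⊆ F
        J⊆F = ⊕-⊆ I-x⊆F f∈F
        B₀-data : Indep (J ⊕ y)
        B₀-data = indep-⊕ M ∣basis∣≡d indepJ J⊆F ∣J∣≡rkF y∉clF
        ¬indepJ⊕x : ¬ Indep (J ⊕ x)
        ¬indepJ⊕x indep = ℕₚ.1+n≰n (begin
          ℕ.suc (r F)   ≡⟨ cong ℕ.suc ∣J∣≡rkF ⟨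
          ℕ.suc ∣ J ∣   ≡⟨ ∣⊕∣ J (x∉F ∘ J⊆F) ⟨
          ∣ J ⊕ x ∣     ≤⟨ ∣indep∣≤rk M indep (⊕-monoˡ J⊆F) ⟩
          r (F ⊕ x)     ≤⟨ x∈clF ⟩
          r F           ∎)
        ¬indepI⊕f : ¬ Indep (I ⊕ f)
        ¬indepI⊕f indep = ℕₚ.1+n≰n (begin
          ℕ.suc (r (F ⊕ x))   ≡⟨ cong ℕ.suc ∣I∣≡ ⟨
          ℕ.suc ∣ I ∣         ≡⟨ ∣⊕∣ I (λ f∈I → f∉I-x (x∈p∧x≢y⇒x∈p-y f∈I f≢x)) ⟨
          ∣ I ⊕ f ∣           ≤⟨ ∣indep∣≤rk M indep (⊕-⊆ I⊆F⊕x (∈-⊕ˡ f∈F)) ⟩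
          r (F ⊕ x)           ∎)
        -- Modulo `F`, `x` has rank 0 and `i` is spanned by `y`, so the rank available is at most
        -- one more than the size of `I`.
        ¬indepI⊕i⊕y : ¬ Indep (I ⊕ i ⊕ y)
        ¬indepI⊕i⊕y indep = ℕₚ.1+n≰n (begin
          ℕ.suc (ℕ.suc (r F))   ≡⟨ cong (ℕ.suc ∘ ℕ.suc) ∣I∣≡rkF ⟨
          ℕ.suc (ℕ.suc ∣ I ∣)   ≡⟨ cong ℕ.suc (∣⊕∣ I i∉I) ⟨
          ℕ.suc ∣ I ⊕ i ∣       ≡⟨ ∣⊕∣ (I ⊕ i) y∉I⊕i ⟨
          ∣ I ⊕ i ⊕ y ∣         ≤⟨ ∣indep∣≤rk M indep ⊆Fyix ⟩
          r (F ⊕ y ⊕ i ⊕ x)     ≤⟨ spans-mono M ∣basis∣≡d (∈-⊕ˡ ∘ ∈-⊕ˡ) x∈clF ⟩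
          r (F ⊕ y ⊕ i)         ≤⟨ i∈clFy ⟩
          r (F ⊕ y)             ≤⟨ rk-⊕≤ M F y ⟩
          ℕ.suc (r F)           ∎)
          where
          ⊆Fyix : I ⊕ i ⊕ y ⊆ F ⊕ y ⊕ i ⊕ x
          ⊆Fyix = ⊕-⊆ (⊕-⊆ (⊕-monoˡ (∈-⊕ˡ ∘ ∈-⊕ˡ) ∘ I⊆F⊕x) (∈-⊕ˡ ∈-⊕ʳ)) (∈-⊕ˡ (∈-⊕ˡ ∈-⊕ʳ))

        found : ∀ B₀ → Basis B₀ → J ⊕ y ⊆ B₀ →
          ∃[ B₁ ] Basis B₁ × I ⊕ i ⊆ B₁ × B₁ ⊆ (I ⊕ i) ∪ B₀ → CrossingBases F x y i
        found B₀ basis₀ Jy⊆B₀ (B₁ , basis₁ , Ii⊆B₁ , B₁⊆) =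
          R , f , f∈F , f∉R , y∉R , x∉R , i∉R
            , subst Basis (sym R⊕f⊕y≡B₀) basis₀
            , subst Basis (⊆∧∣≥∣⇒≡ B₁⊆R⊕x⊕i ∣R⊕x⊕i∣≤∣B₁∣) basis₁
            , λ basis → ¬indepJ⊕x (R ⊕ f ⊕ x , basis , ⊕-monoˡ J⊆R⊕f)
          where
          R = B₀ - f - y
          f∈B₀ : f ∈ B₀
          f∈B₀ = Jy⊆B₀ (∈-⊕ˡ ∈-⊕ʳ)
          y∈B₀ : y ∈ B₀
          y∈B₀ = Jy⊆B₀ ∈-⊕ʳ
          f∉R : f ∉ R
          f∉R = x∉p-x B₀ f ∘ proj₁ ∘ ∈-remove⁻
          y∉R : y ∉ R
          y∉R = x∉p-x (B₀ - f) y
          ∈R : ∀ {z} → z ∈ B₀ → z ≢ f → z ≢ y → z ∈ R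
          ∈R z∈B₀ z≢f z≢y = x∈p∧x≢y⇒x∈p-y (x∈p∧x≢y⇒x∈p-y z∈B₀ z≢f) z≢y
          R⊕f⊕y≡B₀ : R ⊕ f ⊕ y ≡ B₀
          R⊕f⊕y≡B₀ = trans (⊕-comm R f y)
            (trans (cong (_⊕ f) (remove-⊕ (x∈p∧x≢y⇒x∈p-y y∈B₀ (≢-sym f≢y)))) (remove-⊕ f∈B₀))
          2+∣R∣≡d : ℕ.suc (ℕ.suc ∣ R ∣) ≡ d
          2+∣R∣≡d = begin-equality
            ℕ.suc (ℕ.suc ∣ R ∣)   ≡⟨ cong ℕ.suc (∣⊕∣ R f∉R) ⟨
            ℕ.suc ∣ R ⊕ f ∣       ≡⟨ ∣⊕∣ (R ⊕ f) (∉-⊕ y∉R (≢-sym f≢y)) ⟨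
            ∣ R ⊕ f ⊕ y ∣         ≡⟨ cong ∣_∣ R⊕f⊕y≡B₀ ⟩
            ∣ B₀ ∣                ≡⟨ ∣basis∣≡d basis₀ ⟩
            d                     ∎
          -- `I` already spans `f`, and `I ⊕ i` spans `y`, so `B₁` contains neither. What `B₁`
          -- shares with `B₀` therefore lies in `R`, and counting gives `B₁ ≡ R ⊕ x ⊕ i`.
          f∉B₁ : f ∉ B₁
          f∉B₁ f∈B₁ = ¬indepI⊕f (B₁ , basis₁ , ⊕-⊆ (Ii⊆B₁ ∘ ∈-⊕ˡ) f∈B₁)
          y∉B₁ : y ∉ B₁
          y∉B₁ y∈B₁ = ¬indepI⊕i⊕y (B₁ , basis₁ , ⊕-⊆ Ii⊆B₁ y∈B₁)
          B₀∩B₁⊆R : ∀ {z} → z ∈ B₁ → z ∈ B₀ → z ∈ R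
          B₀∩B₁⊆R z∈B₁ z∈B₀ = ∈R z∈B₀ (λ { refl → f∉B₁ z∈B₁ }) (λ { refl → y∉B₁ z∈B₁ })
          B₁⊆R⊕x⊕i : B₁ ⊆ R ⊕ x ⊕ i
          B₁⊆R⊕x⊕i {z} z∈B₁ with x∈p∪q⁻ (I ⊕ i) B₀ (B₁⊆ z∈B₁)
          ... | inj₂ z∈B₀ = ∈-⊕ˡ (∈-⊕ˡ (B₀∩B₁⊆R z∈B₁ z∈B₀))
          ... | inj₁ z∈I⊕i with ∈-⊕⁻ z∈I⊕i
          ... | inj₂ refl = ∈-⊕ʳ
          ... | inj₁ z∈I with z Finₚ.≟ x
          ... | yes refl = ∈-⊕ˡ ∈-⊕ʳ
          ... | no z≢x = ∈-⊕ˡ (∈-⊕ˡ (B₀∩B₁⊆R z∈B₁ (Jy⊆B₀ (∈-⊕ˡ (∈-⊕ˡ (x∈p∧x≢y⇒x∈p-y z∈I z≢x))))))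
          ∣R⊕x⊕i∣≤∣B₁∣ : ∣ R ⊕ x ⊕ i ∣ ℕ.≤ ∣ B₁ ∣
          ∣R⊕x⊕i∣≤∣B₁∣ = begin
            ∣ R ⊕ x ⊕ i ∣         ≤⟨ ∣⊕∣≤ (R ⊕ x) i ⟩
            ℕ.suc ∣ R ⊕ x ∣       ≤⟨ ℕ.s≤s (∣⊕∣≤ R x) ⟩
            ℕ.suc (ℕ.suc ∣ R ∣)   ≡⟨ 2+∣R∣≡d ⟩
            d                     ≡⟨ ∣basis∣≡d basis₁ ⟨
            ∣ B₁ ∣                ∎
          ¬B₁⊆R⊕ : ∀ {z} → ¬ B₁ ⊆ R ⊕ z
          ¬B₁⊆R⊕ {z} B₁⊆R⊕z = ℕₚ.1+n≰n (begin
            ℕ.suc (ℕ.suc ∣ R ∣)   ≡⟨ 2+∣R∣≡d ⟩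
            d                     ≡⟨ ∣basis∣≡d basis₁ ⟨
            ∣ B₁ ∣                ≤⟨ p⊆q⇒∣p∣≤∣q∣ B₁⊆R⊕z ⟩
            ∣ R ⊕ z ∣             ≤⟨ ∣⊕∣≤ R z ⟩
            ℕ.suc ∣ R ∣           ∎)
          x∉R : x ∉ R
          x∉R x∈R = ¬B₁⊆R⊕ (⊕-monoˡ (⊕-⊆ id x∈R) ∘ B₁⊆R⊕x⊕i)
          i∉R : i ∉ R
          i∉R i∈R = ¬B₁⊆R⊕ (⊕-⊆ id (∈-⊕ˡ i∈R) ∘ B₁⊆R⊕x⊕i)
          J⊆R⊕f : J ⊆ R ⊕ f
          J⊆R⊕f {z} z∈J with z Finₚ.≟ f
          ... | yes refl = ∈-⊕ʳ
          ... | no z≢f   = ∈-⊕ˡ (∈R (Jy⊆B₀ (∈-⊕ˡ z∈J)) z≢f λ { refl → y∉F (J⊆F z∈J) })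

-- Cyclic order

module _ {n : ℕ} {P : Fin n → Set} (P? : Decidable P) where

  ∈-tabulate⁺ : ∀ {z} → P z → z ∈ tabulate (does ∘ P?)
  ∈-tabulate⁺ {z} pz = lookup⇒[]= z _ (trans (lookup∘tabulate _ z) (dec (P? z)))
    where
    dec : (d : Dec (P z)) → does d ≡ true
    dec (yes _)  = refl
    dec (no ¬pz) = ⊥-elim (¬pz pz)

  ∈-tabulate⁻ : ∀ {z} → z ∈ tabulate (does ∘ P?) → P z
  ∈-tabulate⁻ {z} z∈ = dec (P? z) (trans (sym (lookup∘tabulate _ z)) ([]=⇒lookup z∈))
    where
    dec : (d : Dec (P z)) → does d ≡ true → P z
    dec (yes pz) _  = pz
    dec (no _)   ()

module _ {n : ℕ} where

  private variable
    a b i j k x y z : Fin n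

  ∈-⟦⟧⁺ : ∀ a b → z ≤[ a ] b → z ∈ ⟦ a , b ⟧
  ∈-⟦⟧⁺ a b = ∈-tabulate⁺ (λ x → x ≤[ a ]? b)

  ∈-⟦⟧⁻ : ∀ a b → z ∈ ⟦ a , b ⟧ → z ≤[ a ] b
  ∈-⟦⟧⁻ a b = ∈-tabulate⁻ (λ x → x ≤[ a ]? b)

  %-cases : ∀ .{{_ : ℕ.NonZero n}} m → m ℕ.< n ℕ.+ n → m ≡ m % n ⊎ m ≡ m % n ℕ.+ n
  %-cases m m<2n with m ℕₚ.<? n
  ... | yes m<n = inj₁ (sym (m<n⇒m%n≡m m<n))
  ... | no  m≮n with ℕₚ.m≤n⇒∃[o]m+o≡n (ℕₚ.≮⇒≥ m≮n)
  ... | k , refl = inj₂ (begin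
      n ℕ.+ k             ≡⟨ ℕₚ.+-comm n k ⟩
      k ℕ.+ n             ≡⟨ cong (ℕ._+ n) (m<n⇒m%n≡m (ℕₚ.+-cancelˡ-< n k n m<2n)) ⟨
      k % n ℕ.+ n         ≡⟨ cong (ℕ._+ n) ([m+n]%n≡m%n k n) ⟨
      (k ℕ.+ n) % n ℕ.+ n ≡⟨ cong (λ t → t % n ℕ.+ n) (ℕₚ.+-comm k n) ⟩
      (n ℕ.+ k) % n ℕ.+ n ∎)
    where open ≡-Reasoning

  steps<n : ∀ a z → steps a z ℕ.< n
  steps<n a z = m%n<n _ n {{Finₚ.nonZeroIndex a}}

  shift : Fin n → ℕ → Fin n
  shift a m = _mod_ (m ℕ.+ toℕ a) n {{Finₚ.nonZeroIndex a}}

  steps-shift : ∀ a {m} → m ℕ.< n → steps a (shift a m) ≡ m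
  steps-shift a {m} m<n = begin
    (toℕ (shift a m) ℕ.+ c) % n
      ≡⟨ cong (λ t → (t ℕ.+ c) % n) (Finₚ.toℕ-fromℕ< _) ⟩
    ((m ℕ.+ toℕ a) % n ℕ.+ c) % n
      ≡⟨ %-distribˡ-+ ((m ℕ.+ toℕ a) % n) c n ⟩
    ((m ℕ.+ toℕ a) % n % n ℕ.+ c % n) % n
      ≡⟨ cong (λ t → (t ℕ.+ c % n) % n) (m%n%n≡m%n (m ℕ.+ toℕ a) n) ⟩
    ((m ℕ.+ toℕ a) % n ℕ.+ c % n) % n
      ≡⟨ %-distribˡ-+ (m ℕ.+ toℕ a) c n ⟨
    (m ℕ.+ toℕ a ℕ.+ c) % n
      ≡⟨ cong (_% n) (trans (ℕₚ.+-assoc m (toℕ a) c) (cong (m ℕ.+_) (ℕₚ.m+[n∸m]≡n (ℕₚ.<⇒≤ (Finₚ.toℕ<n a))))) ⟩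
    (m ℕ.+ n) % n
      ≡⟨ [m+n]%n≡m%n m n ⟩
    m % n
      ≡⟨ m<n⇒m%n≡m m<n ⟩
    m ∎
    where
    open ≡-Reasoning
    instance _ = Finₚ.nonZeroIndex a
    c = n ℕ.∸ toℕ a

  steps-toℕ : ∀ a z → toℕ a ℕ.+ steps a z ≡ toℕ z ⊎ toℕ a ℕ.+ steps a z ≡ toℕ z ℕ.+ n
  steps-toℕ a z = cases (%-cases (toℕ z ℕ.+ c) (ℕₚ.+-mono-<-≤ (Finₚ.toℕ<n z) (ℕₚ.m∸n≤m n (toℕ a))))
    where
    instance _ = Finₚ.nonZeroIndex a
    c = n ℕ.∸ toℕ a
    a+[z+c]≡z+n : toℕ a ℕ.+ (toℕ z ℕ.+ c) ≡ toℕ z ℕ.+ n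
    a+[z+c]≡z+n = trans (solve 3 (λ a z c → a :+ (z :+ c) := z :+ (a :+ c)) refl (toℕ a) (toℕ z) c)
      (cong (toℕ z ℕ.+_) (ℕₚ.m+[n∸m]≡n (ℕₚ.<⇒≤ (Finₚ.toℕ<n a))))
      where open ℕ-Solver
    cases : _ → toℕ a ℕ.+ steps a z ≡ toℕ z ⊎ toℕ a ℕ.+ steps a z ≡ toℕ z ℕ.+ n
    cases (inj₁ e) = inj₂ (trans (cong (toℕ a ℕ.+_) (sym e)) a+[z+c]≡z+n)
    cases (inj₂ e) = inj₁ (ℕₚ.+-cancelʳ-≡ n _ _
      (trans (ℕₚ.+-assoc (toℕ a) _ n) (trans (cong (toℕ a ℕ.+_) (sym e)) a+[z+c]≡z+n)))

  -- Both summands are below `n`, so a detour through `a` costs at most one extra turn. Most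
  -- interval facts below come from excluding one of the two cases.
  steps-+ : ∀ x a z → steps x a ℕ.+ steps a z ≡ steps x z ⊎ steps x a ℕ.+ steps a z ≡ steps x z ℕ.+ n
  steps-+ x a z = subst (λ t → s ≡ t ⊎ s ≡ t ℕ.+ n) s%n≡ (%-cases s (ℕₚ.+-mono-< (steps<n x a) (steps<n a z)))
    where
    open ≡-Reasoning
    instance _ = Finₚ.nonZeroIndex a
    s = steps x a ℕ.+ steps a z
    c = n ℕ.∸ toℕ a
    e = n ℕ.∸ toℕ x
    s%n≡ : s % n ≡ steps x z
    s%n≡ = begin
      s % n                                         ≡⟨ %-distribˡ-+ (toℕ a ℕ.+ e) (toℕ z ℕ.+ c) n ⟨
      (toℕ a ℕ.+ e ℕ.+ (toℕ z ℕ.+ c)) % n           ≡⟨ cong (_% n) (solve 4 (λ a e z c →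
                                                         a :+ e :+ (z :+ c) := z :+ e :+ (a :+ c))
                                                         refl (toℕ a) e (toℕ z) c) ⟩
      (toℕ z ℕ.+ e ℕ.+ (toℕ a ℕ.+ c)) % n           ≡⟨ cong (λ t → (toℕ z ℕ.+ e ℕ.+ t) % n)
                                                         (ℕₚ.m+[n∸m]≡n (ℕₚ.<⇒≤ (Finₚ.toℕ<n a))) ⟩
      (toℕ z ℕ.+ e ℕ.+ n) % n                       ≡⟨ [m+n]%n≡m%n (toℕ z ℕ.+ e) n ⟩
      steps x z                                     ∎
      where open ℕ-Solver

  steps-refl : ∀ a → steps a a ≡ 0
  steps-refl a = trans (cong (_% n) (ℕₚ.m+[n∸m]≡n (ℕₚ.<⇒≤ (Finₚ.toℕ<n a)))) (n%n≡0 n)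
    where instance _ = Finₚ.nonZeroIndex a

  steps≡0 : ∀ a z → steps a z ≡ 0 → z ≡ a
  steps≡0 a z e with steps-toℕ a z
  ... | inj₁ p = Finₚ.toℕ-injective (trans (sym p) (trans (cong (toℕ a ℕ.+_) e) (ℕₚ.+-identityʳ _)))
  ... | inj₂ p = ⊥-elim (ℕₚ.<⇒≱ (Finₚ.toℕ<n a) (subst (n ℕ.≤_)
                   (trans (sym p) (trans (cong (toℕ a ℕ.+_) e) (ℕₚ.+-identityʳ _))) (ℕₚ.m≤n+m n (toℕ z))))

  steps-injective : ∀ a y z → steps a y ≡ steps a z → y ≡ z
  steps-injective a y z e with steps-+ a y z
  ... | inj₁ p = sym (steps≡0 y z (ℕₚ.+-cancelˡ-≡ (steps a y) _ _
                   (trans p (trans (sym e) (sym (ℕₚ.+-identityʳ _))))))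
  ... | inj₂ p = ⊥-elim (ℕₚ.<-irrefl (ℕₚ.+-cancelˡ-≡ (steps a y) _ _ (trans p (cong (ℕ._+ n) (sym e))))
                   (steps<n y z))

  steps>0 : z ≢ a → 0 ℕ.< steps a z
  steps>0 {z} {a} z≢a = ℕₚ.n≢0⇒n>0 (z≢a ∘ steps≡0 a z)

  steps-suc : steps j i ≡ 1 → z ≢ j → steps j z ≡ ℕ.suc (steps i z)
  steps-suc {j} {i} {z} ji≡1 z≢j with steps-+ j i z
  ... | inj₁ p = trans (sym p) (cong (ℕ._+ steps i z) ji≡1)
  ... | inj₂ p = ⊥-elim (ℕₚ.<-irrefl refl (begin-strict
      n                              <⟨ ℕₚ.m<n+m n (steps>0 z≢j) ⟩
      steps j z ℕ.+ n                ≡⟨ p ⟨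
      steps j i ℕ.+ steps i z        ≡⟨ cong (ℕ._+ steps i z) ji≡1 ⟩
      ℕ.suc (steps i z)              ≤⟨ steps<n i z ⟩
      n                              ∎))
    where open ℕₚ.≤-Reasoning

  steps-complement : z ≢ a → steps a z ℕ.+ steps z a ≡ n
  steps-complement {z} {a} z≢a with steps-+ a z a
  ... | inj₁ p = ⊥-elim (z≢a (steps≡0 a z (ℕₚ.m+n≡0⇒m≡0 _ (trans p (steps-refl a)))))
  ... | inj₂ p = trans p (cong (ℕ._+ n) (steps-refl a))

  -- The second element `k` witnesses `1 < n`; in a one-element ground set `next i` would be `i`
  -- itself.
  steps-next : k ≢ i → steps i (next i) ≡ 1
  steps-next {k} {i} k≢i = steps-shift i (ℕₚ.≤-<-trans (steps>0 k≢i) (steps<n i k))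

  ∈-⟦next⟧⁺ : k ≢ i → z ≢ i → z ≤[ i ] k → z ∈ ⟦ next i , k ⟧
  ∈-⟦next⟧⁺ {k} {i} {z} k≢i z≢i z≤k = ∈-⟦⟧⁺ (next i) k (ℕ.s≤s⁻¹
    (subst₂ ℕ._≤_ (steps-suc (steps-next k≢i) z≢i) (steps-suc (steps-next k≢i) k≢i) z≤k))

  ∈-⟦next⟧⁻ : k ≢ i → z ∈ ⟦ next i , k ⟧ → z ≢ i × z ≤[ i ] k
  ∈-⟦next⟧⁻ {k} {i} {z} k≢i z∈ = z≢i , subst₂ ℕ._≤_ (sym (steps-suc (steps-next k≢i) z≢i))
                                         (sym (steps-suc (steps-next k≢i) k≢i)) (ℕ.s≤s (∈-⟦⟧⁻ (next i) k z∈))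
    where
    open ℕₚ.≤-Reasoning
    next≢i : next i ≢ i
    next≢i e = ℕₚ.0≢1+n (trans (sym (steps-refl i)) (trans (cong (steps i) (sym e)) (steps-next k≢i)))
    z≢i : z ≢ i
    z≢i refl = ℕₚ.<-irrefl refl (begin-strict
      n                                             ≡⟨ steps-complement next≢i ⟨
      steps i (next i) ℕ.+ steps (next i) i         ≤⟨ ℕₚ.+-monoʳ-≤ (steps i (next i)) (∈-⟦⟧⁻ (next i) k z∈) ⟩
      steps i (next i) ℕ.+ steps (next i) k         ≡⟨ cong (ℕ._+ steps (next i) k) (steps-next k≢i) ⟩
      ℕ.suc (steps (next i) k)                      ≡⟨ steps-suc (steps-next k≢i) k≢i ⟨
      steps i k                                     <⟨ steps<n i k ⟩
      n                                             ∎)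

  -- Counted from `i`, the arrow runs from `y` to the last element and then ends in `i`, whose count
  -- is 0 and not `n`; hence the separate case `z ≡ i`.
  ∈-arrow⁺ : y ≢ i → z ≡ i ⊎ steps i y ℕ.≤ steps i z → z ∈ ⟦ y , i ⟧
  ∈-arrow⁺ {y} {i} y≢i (inj₁ refl) = ∈-⟦⟧⁺ y i ℕₚ.≤-refl
  ∈-arrow⁺ {y} {i} {z} y≢i (inj₂ y≤z) with steps-+ i y z
  ... | inj₁ p = ∈-⟦⟧⁺ y i (ℕₚ.+-cancelˡ-≤ (steps i y) _ _
                   (subst₂ ℕ._≤_ (sym p) (sym (steps-complement y≢i)) (ℕₚ.<⇒≤ (steps<n i z))))
  ... | inj₂ p = ⊥-elim (ℕₚ.<⇒≱ (steps<n y z) (ℕₚ.+-cancelˡ-≤ (steps i y) _ _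
                   (subst (steps i y ℕ.+ n ℕ.≤_) (sym p) (ℕₚ.+-monoˡ-≤ n y≤z))))

  ∈-arrow⁻ : y ≢ i → z ∈ ⟦ y , i ⟧ → z ≡ i ⊎ steps i y ℕ.≤ steps i z
  ∈-arrow⁻ {y} {i} {z} y≢i z∈ with steps-+ i y z
  ... | inj₁ p = inj₂ (subst (steps i y ℕ.≤_) p (ℕₚ.m≤m+n (steps i y) (steps y z)))
  ... | inj₂ p = inj₁ (steps≡0 i z (ℕₚ.n≤0⇒n≡0 (ℕₚ.+-cancelʳ-≤ n _ _
                   (subst₂ ℕ._≤_ p (steps-complement y≢i) (ℕₚ.+-monoʳ-≤ (steps i y) (∈-⟦⟧⁻ y i z∈))))))

-- Arrows and flats

module _ {n : ℕ} where

  private variable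
    a b i j k x y z : Fin n
    m : ℕ

  inArc? : ∀ i m (z : Fin n) → Dec (0 ℕ.< steps i z × steps i z ℕ.≤ m)
  inArc? i m z = (0 ℕₚ.<? steps i z) ×-dec (steps i z ℕₚ.≤? m)

  -- The half-open arc (i, i+m]. Naming the left neighbour `i` instead of the first element lets
  -- `m = 0` mean the empty arc; if `y` is `m + 1` steps from `i`, the complement is `⟦ y , i ⟧`.
  arc : Fin n → ℕ → Subset n
  arc i m = tabulate (does ∘ inArc? i m)

  ∈-arc⁺ : ∀ i m → 0 ℕ.< steps i z → steps i z ℕ.≤ m → z ∈ arc i m
  ∈-arc⁺ i m 0<z z≤m = ∈-tabulate⁺ (inArc? i m) (0<z , z≤m)

  ∈-arc⁻ : ∀ i m → z ∈ arc i m → 0 ℕ.< steps i z × steps i z ℕ.≤ m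
  ∈-arc⁻ i m = ∈-tabulate⁻ (inArc? i m)

  i∉arc : ∀ i m → i ∉ arc i m
  i∉arc i m i∈ = ℕₚ.<-irrefl (sym (steps-refl i)) (proj₁ (∈-arc⁻ i m i∈))

  arc-growʳ : ∀ i m y → steps i y ≡ ℕ.suc m → arc i (ℕ.suc m) ⊆ arc i m ⊕ y
  arc-growʳ i m y y≡1+m {z} z∈ with ∈-arc⁻ i (ℕ.suc m) z∈
  ... | 0<z , z≤1+m with ℕₚ.m≤n⇒m<n∨m≡n z≤1+m
  ... | inj₁ z<1+m = ∈-⊕ˡ (∈-arc⁺ i m 0<z (ℕ.s≤s⁻¹ z<1+m))
  ... | inj₂ z≡1+m = subst (_∈ arc i m ⊕ y) (steps-injective i y z (trans y≡1+m (sym z≡1+m))) ∈-⊕ʳ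

  arc-growˡ : ∀ i j m → steps j i ≡ 1 → arc j (ℕ.suc m) ⊆ arc i m ⊕ i
  arc-growˡ i j m ji≡1 {z} z∈ with z Finₚ.≟ i | z Finₚ.≟ j
  ... | yes refl | _        = ∈-⊕ʳ
  ... | no z≢i   | yes refl = ⊥-elim (i∉arc j (ℕ.suc m) z∈)
  ... | no z≢i   | no z≢j   = ∈-⊕ˡ (∈-arc⁺ i m (steps>0 z≢i) (ℕ.s≤s⁻¹
        (subst (ℕ._≤ ℕ.suc m) (steps-suc ji≡1 z≢j) (proj₂ (∈-arc⁻ j (ℕ.suc m) z∈)))))

  arc-⊆-growʳ : ∀ i m → arc i m ⊆ arc i (ℕ.suc m)
  arc-⊆-growʳ i m z∈ with ∈-arc⁻ i m z∈
  ... | 0<z , z≤m = ∈-arc⁺ i (ℕ.suc m) 0<z (ℕₚ.m≤n⇒m≤1+n z≤m)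

  ∈-arrow⇒∉-arc : y ≢ i → steps i y ≡ ℕ.suc m → z ∈ ⟦ y , i ⟧ → z ∉ arc i m
  ∈-arrow⇒∉-arc {y = y} {i = i} {m = m} y≢i y≡1+m z∈ z∈arc with ∈-arrow⁻ y≢i z∈
  ... | inj₁ refl = i∉arc i m z∈arc
  ... | inj₂ y≤z  = ℕₚ.<⇒≱ (ℕ.s≤s (proj₂ (∈-arc⁻ i m z∈arc))) (subst (ℕ._≤ _) y≡1+m y≤z)

  ∉-arc⇒∈-arrow : y ≢ i → steps i y ≡ ℕ.suc m → z ∉ arc i m → z ∈ ⟦ y , i ⟧
  ∉-arc⇒∈-arrow {y = y} {i = i} {m = m} {z = z} y≢i y≡1+m z∉arc with z Finₚ.≟ i
  ... | yes z≡i = ∈-arrow⁺ y≢i (inj₁ z≡i)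
  ... | no  z≢i = ∈-arrow⁺ y≢i (inj₂ (subst (ℕ._≤ steps i z) (sym y≡1+m)
                    (ℕₚ.≰⇒> (z∉arc ∘ ∈-arc⁺ i m (steps>0 z≢i)))))

  ⟦next⟧-⊕ : k ≢ i → ⟦ next i , k ⟧ ⊕ i ≡ ⟦ i , k ⟧
  ⟦next⟧-⊕ {k} {i} k≢i = ⊆-antisym
    (⊕-⊆ (∈-⟦⟧⁺ i k ∘ proj₂ ∘ ∈-⟦next⟧⁻ k≢i) (∈-⟦⟧⁺ i k (subst (ℕ._≤ steps i k) (sym (steps-refl i)) ℕ.z≤n)))
    (λ {z} z∈ → back z z∈ (z Finₚ.≟ i))
    where
    back : ∀ z → z ∈ ⟦ i , k ⟧ → Dec (z ≡ i) → z ∈ ⟦ next i , k ⟧ ⊕ i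
    back z z∈ (yes refl) = ∈-⊕ʳ
    back z z∈ (no z≢i)   = ∈-⊕ˡ (∈-⟦next⟧⁺ k≢i z≢i (∈-⟦⟧⁻ i k z∈))

  CyclicallyOrdered : (i f y x : Fin n) → Set
  CyclicallyOrdered i f y x =
      (i Fin.< f × f Fin.< y × y Fin.< x)
    ⊎ (x Fin.< i × i Fin.< f × f Fin.< y)
    ⊎ (y Fin.< x × x Fin.< i × i Fin.< f)
    ⊎ (f Fin.< y × y Fin.< x × x Fin.< i)

  -- Once an element has wrapped past the largest label, all later ones have; the number of wrapped
  -- elements among `f`, `y`, `x` selects the rotation.
  cyclically-ordered : ∀ i f y x → 0 ℕ.< steps i f → f <[ i ] y → y <[ i ] x → CyclicallyOrdered i f y x
  cyclically-ordered i f y x 0<f f<y y<x = cases (steps-toℕ i f) (steps-toℕ i y) (steps-toℕ i x)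
    where
    open ℕₚ.≤-Reasoning
    Unwrapped Wrapped : Fin n → Set
    Unwrapped z = toℕ i ℕ.+ steps i z ≡ toℕ z
    Wrapped z = toℕ i ℕ.+ steps i z ≡ toℕ z ℕ.+ n
    above : ∀ z → 0 ℕ.< steps i z → Unwrapped z → i Fin.< z
    above z 0<z u = subst (toℕ i ℕ.<_) u (ℕₚ.m<m+n (toℕ i) 0<z)
    below : ∀ z → Wrapped z → z Fin.< i
    below z w = ℕₚ.+-cancelʳ-< n (toℕ z) (toℕ i)
      (subst (ℕ._< toℕ i ℕ.+ n) w (ℕₚ.+-monoʳ-< (toℕ i) (steps<n i z)))
    both-unwrapped : ∀ w z → w <[ i ] z → Unwrapped w → Unwrapped z → w Fin.< z
    both-unwrapped w z w<z u v = subst₂ ℕ._<_ u v (ℕₚ.+-monoʳ-< (toℕ i) w<z)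
    both-wrapped : ∀ w z → w <[ i ] z → Wrapped w → Wrapped z → w Fin.< z
    both-wrapped w z w<z u v = ℕₚ.+-cancelʳ-< n (toℕ w) (toℕ z)
      (subst₂ ℕ._<_ u v (ℕₚ.+-monoʳ-< (toℕ i) w<z))
    unwrapped-after-wrapped : ∀ w z → w <[ i ] z → Wrapped w → ¬ Unwrapped z
    unwrapped-after-wrapped w z w<z u v = ℕₚ.<-irrefl refl (begin-strict
      toℕ z                     <⟨ Finₚ.toℕ<n z ⟩
      n                         ≤⟨ ℕₚ.m≤n+m n (toℕ w) ⟩
      toℕ w ℕ.+ n               ≡⟨ u ⟨
      toℕ i ℕ.+ steps i w       <⟨ ℕₚ.+-monoʳ-< (toℕ i) w<z ⟩
      toℕ i ℕ.+ steps i z       ≡⟨ v ⟩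
      toℕ z                     ∎)
    cases : Unwrapped f ⊎ Wrapped f → Unwrapped y ⊎ Wrapped y → Unwrapped x ⊎ Wrapped x → CyclicallyOrdered i f y x
    cases (inj₁ uf) (inj₁ uy) (inj₁ ux) =
      inj₁ (above f 0<f uf , both-unwrapped f y f<y uf uy , both-unwrapped y x y<x uy ux)
    cases (inj₁ uf) (inj₁ uy) (inj₂ wx) =
      inj₂ (inj₁ (below x wx , above f 0<f uf , both-unwrapped f y f<y uf uy))
    cases (inj₁ uf) (inj₂ wy) (inj₂ wx) =
      inj₂ (inj₂ (inj₁ (both-wrapped y x y<x wy wx , below x wx , above f 0<f uf)))
    cases (inj₂ wf) (inj₂ wy) (inj₂ wx) =
      inj₂ (inj₂ (inj₂ (both-wrapped f y f<y wf wy , both-wrapped y x y<x wy wx , below x wx)))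
    cases (inj₂ wf) (inj₁ uy) _         = ⊥-elim (unwrapped-after-wrapped f y f<y wf uy)
    cases _         (inj₂ wy) (inj₁ ux) = ⊥-elim (unwrapped-after-wrapped y x y<x wy ux)

-- Decorated permutations in terms of closure, and the two implications

module _ {n : ℕ} (M : Matroid n) where
  open Matroid M

  private
    Indep : Subset n → Set
    Indep = Independent M

    r : Subset n → ℕ
    r = rk M

    flip⊕ : ∀ {S x y} → Basis (S ⊕ x ⊕ y) → Basis (S ⊕ y ⊕ x)
    flip⊕ {S} {x} {y} = subst Basis (⊕-comm S x y)

  -- In the cyclic order `i`, `f`, `y`, `x` the pairs fy and xi are opposite sides and fx is a
  -- diagonal. The rotation decides which pair of sides and which diagonal they are in the linear
  -- order.
  noncrossing-cyclic : Noncrossing M → ∀ S {i f y x} → CyclicallyOrdered i f y x →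
    i ∉ S → f ∉ S → y ∉ S → x ∉ S → Basis (S ⊕ f ⊕ y) → Basis (S ⊕ x ⊕ i) → Basis (S ⊕ f ⊕ x)
  noncrossing-cyclic nc S (inj₁ (i<f , f<y , y<x)) i∉S f∉S y∉S x∉S fy xi =
    proj₂ (nc S i<f f<y y<x i∉S f∉S y∉S x∉S (inj₂ (flip⊕ xi , fy)))
  noncrossing-cyclic nc S (inj₂ (inj₁ (x<i , i<f , f<y))) i∉S f∉S y∉S x∉S fy xi =
    flip⊕ (proj₁ (nc S x<i i<f f<y x∉S i∉S f∉S y∉S (inj₁ (xi , fy))))
  noncrossing-cyclic nc S (inj₂ (inj₂ (inj₁ (y<x , x<i , i<f)))) i∉S f∉S y∉S x∉S fy xi =
    flip⊕ (proj₂ (nc S y<x x<i i<f y∉S x∉S i∉S f∉S (inj₂ (flip⊕ fy , xi))))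
  noncrossing-cyclic nc S (inj₂ (inj₂ (inj₂ (f<y , y<x , x<i)))) i∉S f∉S y∉S x∉S fy xi =
    proj₁ (nc S f<y y<x x<i f∉S y∉S x∉S i∉S (inj₁ (fy , xi)))

  closes⇒spans : ∀ {i k} → k ≢ i → r ⟦ i , k ⟧ ≡ r ⟦ next i , k ⟧ → Spans M ⟦ next i , k ⟧ i
  closes⇒spans k≢i e = ℕₚ.≤-reflexive (trans (cong r (⟦next⟧-⊕ k≢i)) e)

  spans⇒closes : ∀ {i k} → k ≢ i → Spans M ⟦ next i , k ⟧ i → r ⟦ i , k ⟧ ≡ r ⟦ next i , k ⟧
  spans⇒closes k≢i spans = trans (cong r (sym (⟦next⟧-⊕ k≢i))) (ℕₚ.≤-antisym spans (rk-mono M ∈-⊕ˡ))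

  module _ {d : ℕ} (∣basis∣≡d : ∀ {B} → Basis B → ∣ B ∣ ≡ d) where

    -- A basis avoiding `x` would lie in `F` and give it full rank, so `F` would span `x`.
    coloop : ∀ {F x} → ¬ Spans M F x → (∀ z → z ≢ x → z ∈ F) → IsColoop M x
    coloop {F} {x} ¬spans full B basis with x ∈? B
    ... | yes x∈B = x∈B
    ... | no  x∉B with rk-attained M (F ⊕ x)
    ... | I , (C , basisC , I⊆C) , _ , ∣I∣≡ = ⊥-elim (¬spans (begin
        r (F ⊕ x)   ≡⟨ ∣I∣≡ ⟨
        ∣ I ∣       ≤⟨ p⊆q⇒∣p∣≤∣q∣ I⊆C ⟩
        ∣ C ∣       ≡⟨ ∣basis∣≡d basisC ⟩
        d           ≡⟨ ∣basis∣≡d basis ⟨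
        ∣ B ∣       ≤⟨ ∣indep∣≤rk M (B , basis , id) (λ {z} z∈B → full z λ { refl → x∉B z∈B }) ⟩
        r F         ∎))
      where open ℕₚ.≤-Reasoning

    module _ (π : Permutation′ n) (decorated : IsDecoratedPermutation M π) where

      spans-arrow : ∀ {i m} → steps i (π ⟨$⟩ʳ i) ≡ ℕ.suc m → Spans M (arc i m ⊕ (π ⟨$⟩ʳ i)) i
      spans-arrow {i} {m} y≡1+m with decorated i
      ... | y≢i , closes , _ = spans-mono M ∣basis∣≡d ⊆arc⊕y (closes⇒spans y≢i closes)
        where
        ⊆arc⊕y : ⟦ next i , π ⟨$⟩ʳ i ⟧ ⊆ arc i m ⊕ (π ⟨$⟩ʳ i)
        ⊆arc⊕y z∈ with ∈-⟦next⟧⁻ y≢i z∈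
        ... | z≢i , z≤y = arc-growʳ i m (π ⟨$⟩ʳ i) y≡1+m
          (∈-arc⁺ i (ℕ.suc m) (steps>0 z≢i) (subst (steps i _ ℕ.≤_) y≡1+m z≤y))

      -- The last element `k` of the arc comes before `π i`, the first end at which `i` is spanned.
      -- The element `z` makes the arc nonempty, so that `k` exists.
      ¬spans-arrow : ∀ {i m z} → steps i (π ⟨$⟩ʳ i) ≡ ℕ.suc m → z ∈ arc i m → ¬ Spans M (arc i m) i
      ¬spans-arrow {i} {ℕ.zero}  {z} y≡1+m z∈ _ with ∈-arc⁻ i 0 z∈
      ... | 0<z , z≤0 = ℕₚ.<⇒≱ 0<z z≤0
      ¬spans-arrow {i} {ℕ.suc m} {z} y≡2+m z∈ spans = proj₂ (proj₂ (decorated i)) k k≢i k<y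
          (spans⇒closes k≢i (spans-mono M ∣basis∣≡d arc⊆ spans))
        where
        y = π ⟨$⟩ʳ i
        k = shift i (ℕ.suc m)
        k≡1+m : steps i k ≡ ℕ.suc m
        k≡1+m = steps-shift i (ℕₚ.<-trans (ℕₚ.n<1+n _) (subst (ℕ._< n) y≡2+m (steps<n i y)))
        k≢i : k ≢ i
        k≢i k≡i = ℕₚ.0≢1+n (trans (sym (steps-refl i)) (trans (cong (steps i) (sym k≡i)) k≡1+m))
        k<y : k <[ i ] y
        k<y = subst₂ ℕ._<_ (sym k≡1+m) (sym y≡2+m) (ℕₚ.n<1+n _)
        arc⊆ : arc i (ℕ.suc m) ⊆ ⟦ next i , k ⟧
        arc⊆ {w} w∈ = ∈-⟦next⟧⁺ k≢i (λ { refl → i∉arc i (ℕ.suc m) w∈ })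
          (subst (steps i w ℕ.≤_) (sym k≡1+m) (proj₂ (∈-arc⁻ i (ℕ.suc m) w∈)))

      -- If `π i` came before `y`, its interval would lie in the arc, which would then span `i`; if
      -- it came after `y`, it would not be the first end at which `i` is spanned.
      decorated-image : ∀ {i m y} → steps i y ≡ ℕ.suc m → y ≢ i →
        ¬ Spans M (arc i m) i → Spans M (arc i m ⊕ y) i → π ⟨$⟩ʳ i ≡ y
      decorated-image {i} {m} {y} y≡1+m y≢i ¬spans spans with decorated i
      ... | j≢i , closes , first with ℕₚ.<-cmp (steps i (π ⟨$⟩ʳ i)) (steps i y)
      ... | tri≈ _ e _ = steps-injective i _ _ e
      ... | tri< j<y _ _ = ⊥-elim (¬spans (spans-mono M ∣basis∣≡d ⊆arc (closes⇒spans j≢i closes)))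
        where
        ⊆arc : ⟦ next i , π ⟨$⟩ʳ i ⟧ ⊆ arc i m
        ⊆arc z∈ with ∈-⟦next⟧⁻ j≢i z∈
        ... | z≢i , z≤j = ∈-arc⁺ i m (steps>0 z≢i)
          (ℕ.s≤s⁻¹ (subst (ℕ.suc (steps i _) ℕ.≤_) y≡1+m (ℕₚ.≤-<-trans z≤j j<y)))
      ... | tri> _ _ y<j = ⊥-elim (first y y≢i y<j (spans⇒closes y≢i (spans-mono M ∣basis∣≡d arc⊕y⊆ spans)))
        where
        arc⊆ : arc i m ⊆ ⟦ next i , y ⟧
        arc⊆ {w} w∈ = ∈-⟦next⟧⁺ y≢i (λ { refl → i∉arc i m w∈ })
          (subst (steps i w ℕ.≤_) (sym y≡1+m) (ℕₚ.m≤n⇒m≤1+n (proj₂ (∈-arc⁻ i m w∈))))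
        arc⊕y⊆ : arc i m ⊕ y ⊆ ⟦ next i , y ⟧
        arc⊕y⊆ = ⊕-⊆ arc⊆ (∈-⟦next⟧⁺ y≢i y≢i ℕₚ.≤-refl)

      -- Induction on `k`, one less than the number of elements outside the arc. When neither
      -- extension leaves `x` outside and unspanned, the two neighbours bound an arrow. With `k = 0`
      -- only `i` is outside, so `x` is `i`, a coloop.
      grow-to-arrow : Coloopless M → ∀ {E x} k i m → ℕ.suc (m ℕ.+ k) ≡ n →
        E ⊆ arc i m → x ∉ arc i m → ¬ Spans M (arc i m) x →
        ∃[ T ] IsCCWArrow π T × x ∈ T × T ⊆ ∁ E
      grow-to-arrow coloopless {x = x} ℕ.zero i m 1+m+0≡n E⊆ x∉ ¬spans =
        ⊥-elim (coloopless x (coloop ¬spans λ z z≢x → others∈arc (z≢x ∘ λ z≡i → trans z≡i (sym x≡i))))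
        where
        others∈arc : ∀ {z} → z ≢ i → z ∈ arc i m
        others∈arc {z} z≢i = ∈-arc⁺ i m (steps>0 z≢i) (ℕ.s≤s⁻¹ (subst (steps i z ℕ.<_)
          (trans (sym 1+m+0≡n) (cong ℕ.suc (ℕₚ.+-identityʳ m))) (steps<n i z)))
        x≡i : x ≡ i
        x≡i = decidable-stable (x Finₚ.≟ i) (x∉ ∘ others∈arc)
      grow-to-arrow coloopless {E} {x} (ℕ.suc k) i m 1+m+1+k≡n E⊆ x∉ ¬spans = choose right left
        where
        2+m+k≡n : ℕ.suc (ℕ.suc m ℕ.+ k) ≡ n
        2+m+k≡n = trans (cong ℕ.suc (sym (ℕₚ.+-suc m k))) 1+m+1+k≡n
        1+m<n : ℕ.suc m ℕ.< n
        1+m<n = subst (ℕ.suc m ℕ.<_) 2+m+k≡n (ℕ.s≤s (ℕₚ.m≤m+n (ℕ.suc m) k))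
        y = shift i (ℕ.suc m)
        y≡1+m : steps i y ≡ ℕ.suc m
        y≡1+m = steps-shift i 1+m<n
        y≢i : y ≢ i
        y≢i y≡i = ℕₚ.0≢1+n (trans (sym (steps-refl i)) (trans (cong (steps i) (sym y≡i)) y≡1+m))
        n-1 = ℕ.suc m ℕ.+ k
        -- The predecessor of `i`, which becomes the left neighbour once `i` joins the arc.
        j = shift i n-1
        j≡n-1 : steps i j ≡ n-1
        j≡n-1 = steps-shift i (ℕₚ.≤-reflexive 2+m+k≡n)
        j≢i : j ≢ i
        j≢i j≡i = ℕₚ.0≢1+n (trans (sym (steps-refl i)) (trans (cong (steps i) (sym j≡i)) j≡n-1))
        ji≡1 : steps j i ≡ 1
        ji≡1 = ℕₚ.+-cancelˡ-≡ n-1 _ _ (trans (cong (ℕ._+ steps j i) (sym j≡n-1))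
          (trans (steps-complement j≢i) (trans (sym 2+m+k≡n) (sym (ℕₚ.+-comm n-1 1)))))

        Result = ∃[ T ] IsCCWArrow π T × x ∈ T × T ⊆ ∁ E

        right : Result ⊎ (x ≡ y ⊎ Spans M (arc i m ⊕ y) x)
        right with x Finₚ.≟ y | r (arc i (ℕ.suc m) ⊕ x) ℕₚ.≤? r (arc i (ℕ.suc m))
        ... | yes x≡y | _         = inj₂ (inj₁ x≡y)
        ... | no _    | yes spans = inj₂ (inj₂ (spans-mono M ∣basis∣≡d (arc-growʳ i m y y≡1+m) spans))
        ... | no x≢y  | no ¬spans′ = inj₁ (grow-to-arrow coloopless k i (ℕ.suc m) 2+m+k≡n
                                     (arc-⊆-growʳ i m ∘ E⊆)
                                     ([ x∉ , x≢y ]′ ∘ ∈-⊕⁻ ∘ arc-growʳ i m y y≡1+m) ¬spans′)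

        left : Result ⊎ (x ≡ i ⊎ Spans M (arc i m ⊕ i) x)
        left with x Finₚ.≟ i | r (arc j (ℕ.suc m) ⊕ x) ℕₚ.≤? r (arc j (ℕ.suc m))
        ... | yes x≡i | _         = inj₂ (inj₁ x≡i)
        ... | no _    | yes spans = inj₂ (inj₂ (spans-mono M ∣basis∣≡d (arc-growˡ i j m ji≡1) spans))
        ... | no x≢i  | no ¬spans′ = inj₁ (grow-to-arrow coloopless k j (ℕ.suc m) 2+m+k≡n
                                     (arc⊆ ∘ E⊆)
                                     ([ x∉ , x≢i ]′ ∘ ∈-⊕⁻ ∘ arc-growˡ i j m ji≡1) ¬spans′)
          where
          arc⊆ : arc i m ⊆ arc j (ℕ.suc m)
          arc⊆ {z} z∈ = ∈-arc⁺ j (ℕ.suc m) (steps>0 z≢j)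
                          (subst (ℕ._≤ ℕ.suc m) (sym (steps-suc ji≡1 z≢j)) (ℕ.s≤s (proj₂ (∈-arc⁻ i m z∈))))
            where
            z≢j : z ≢ j
            z≢j refl = ℕₚ.1+n≰n (ℕₚ.≤-trans (ℕₚ.m≤m+n (ℕ.suc m) k)
                         (subst (ℕ._≤ m) j≡n-1 (proj₂ (∈-arc⁻ i m z∈))))

        arrow : ¬ Spans M (arc i m) i → Spans M (arc i m ⊕ y) i → Result
        arrow ¬spans-i spans-i = ⟦ y , i ⟧
          , (y , cong ⟦ y ,_⟧ (sym (trans (cong (π ⟨$⟩ˡ_) (sym πi≡y)) (inverseˡ π))))
          , ∉-arc⇒∈-arrow y≢i y≡1+m x∉
          , λ z∈ → x∉p⇒x∈∁p (∈-arrow⇒∉-arc y≢i y≡1+m z∈ ∘ E⊆)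
          where πi≡y = decorated-image y≡1+m y≢i ¬spans-i spans-i

        choose : Result ⊎ (x ≡ y ⊎ Spans M (arc i m ⊕ y) x) → Result ⊎ (x ≡ i ⊎ Spans M (arc i m ⊕ i) x) → Result
        choose (inj₁ res) _ = res
        choose (inj₂ _) (inj₁ res) = res
        choose (inj₂ (inj₁ x≡y)) (inj₂ (inj₁ x≡i)) = ⊥-elim (y≢i (trans (sym x≡y) x≡i))
        choose (inj₂ (inj₂ x∈clFy)) (inj₂ (inj₁ refl)) = arrow ¬spans x∈clFy
        -- The arc does not span `i`, since together with `i` it spans `x` and alone it does not.
        -- Exchange makes `i` spanned by the arc with `x`, and `x` is `y` or spanned by the arc with
        -- `y`.
        choose (inj₂ x-y) (inj₂ (inj₂ x∈clFi)) = arrow (¬spans ∘ spans-cancel M x∈clFi) (i∈clFy x-y)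
          where
          i∈clFx : Spans M (arc i m ⊕ x) i
          i∈clFx = spans-exchange M x∈clFi ¬spans
          i∈clFy : x ≡ y ⊎ Spans M (arc i m ⊕ y) x → Spans M (arc i m ⊕ y) i
          i∈clFy (inj₁ refl)   = i∈clFx
          i∈clFy (inj₂ x∈clFy) = spans-trans M ∣basis∣≡d i∈clFx x∈clFy

      flat⇒covered : Coloopless M → ∀ a b → IsFlat M ⟦ a , b ⟧ → CoveredByCCWArrows π (∁ ⟦ a , b ⟧)
      flat⇒covered coloopless a b flat x x∈∁E =
        grow-to-arrow coloopless k i m 1+m+k≡n E⊆arc x∉arc
          (ℕₚ.<⇒≱ (flat x x∉E) ∘ λ spans → spans-mono M ∣basis∣≡d arc⊆E spans)
        where
        x∉E : x ∉ ⟦ a , b ⟧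
        x∉E = x∈∁p⇒x∉p x∈∁E
        -- The number of elements of the interval. With `i`, `n - 1` steps after `a`, as its left
        -- neighbour, the interval is `arc i m`; the outside element `x` gives `m < n`.
        m = ℕ.suc (steps a b)
        1+m≤n : m ℕ.< n
        1+m≤n = ℕₚ.≤-<-trans (ℕₚ.≰⇒> (x∉E ∘ ∈-⟦⟧⁺ a b)) (steps<n a x)
        k = n ℕ.∸ ℕ.suc m
        1+m+k≡n : ℕ.suc (m ℕ.+ k) ≡ n
        1+m+k≡n = ℕₚ.m+[n∸m]≡n 1+m≤n
        i = shift a (m ℕ.+ k)
        ai≡ : steps a i ≡ m ℕ.+ k
        ai≡ = steps-shift a (ℕₚ.≤-reflexive 1+m+k≡n)
        i≢a : i ≢ a
        i≢a i≡a = ℕₚ.0≢1+n (trans (sym (steps-refl a)) (trans (cong (steps a) (sym i≡a)) ai≡))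
        ia≡1 : steps i a ≡ 1
        ia≡1 = ℕₚ.+-cancelˡ-≡ (m ℕ.+ k) _ _ (trans (cong (ℕ._+ steps i a) (sym ai≡))
          (trans (steps-complement i≢a) (trans (sym 1+m+k≡n) (sym (ℕₚ.+-comm (m ℕ.+ k) 1)))))
        E⊆arc : ⟦ a , b ⟧ ⊆ arc i m
        E⊆arc {z} z∈ = ∈-arc⁺ i m (steps>0 z≢i)
          (subst (ℕ._≤ m) (sym (steps-suc ia≡1 z≢i)) (ℕ.s≤s (∈-⟦⟧⁻ a b z∈)))
          where
          z≢i : z ≢ i
          z≢i refl = ℕₚ.1+n≰n (ℕₚ.≤-trans (ℕₚ.m≤m+n m k) (subst (ℕ._≤ steps a b) ai≡ (∈-⟦⟧⁻ a b z∈)))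
        arc⊆E : arc i m ⊆ ⟦ a , b ⟧
        arc⊆E {z} z∈ = ∈-⟦⟧⁺ a b (ℕ.s≤s⁻¹ (subst (ℕ._≤ m)
          (steps-suc {j = i} {i = a} {z = z} ia≡1 z≢i) (proj₂ (∈-arc⁻ i m z∈))))
          where
          z≢i : z ≢ i
          z≢i refl = i∉arc i m z∈
        x∉arc : x ∉ arc i m
        x∉arc = x∉E ∘ arc⊆E

      module _ (nc : Noncrossing M) (loopless : Loopless M) where

        arrow-unspanned : ∀ i m {x a} → steps i (π ⟨$⟩ʳ i) ≡ ℕ.suc m → a ∈ arc i m →
          x ∈ ⟦ π ⟨$⟩ʳ i , i ⟧ → ¬ Spans M (arc i m) x
        arrow-unspanned i m {x} {a} y≡1+m a∈F x∈arrow x∈clF =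
          absurd (crossing-bases M ∣basis∣≡d (decidable-stable (independent? M ⁅ x ⁆) (loopless x))
                   (∈-arrow⇒∉-arc y≢i y≡1+m x∈arrow) x∈clF y∉clF i∉clF i∈clFy y≢i)
          where
          F = arc i m
          y = π ⟨$⟩ʳ i
          y≢i : y ≢ i
          y≢i = proj₁ (decorated i)
          i∉clF : ¬ Spans M F i
          i∉clF = ¬spans-arrow y≡1+m a∈F
          i∈clFy : Spans M (F ⊕ y) i
          i∈clFy = spans-arrow y≡1+m
          y∉clF : ¬ Spans M F y
          y∉clF y∈clF = i∉clF (spans-cancel M i∈clFy y∈clF)
          -- `F` spans `x` but neither `y` nor `i`, so `x` is not an end of the arrow and the cyclic
          -- order is strict.
          y<x : y <[ i ] x
          y<x = [ (λ { refl → ⊥-elim (i∉clF x∈clF) })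
                , (λ y≤x → ℕₚ.≤∧≢⇒< y≤x λ e → y∉clF (subst (Spans M F) (sym (steps-injective i y x e)) x∈clF)) ]′
                (∈-arrow⁻ y≢i x∈arrow)
          absurd : CrossingBases M F x y i → ⊥
          absurd (S , f , f∈F , f∉S , y∉S , x∉S , i∉S , fy , xi , ¬fx) =
            ¬fx (noncrossing-cyclic nc S
              (cyclically-ordered i f y x (proj₁ (∈-arc⁻ i m f∈F)) f<y y<x) i∉S f∉S y∉S x∉S fy xi)
            where
            f<y : f <[ i ] y
            f<y = subst (steps i f ℕ.<_) (sym y≡1+m) (ℕ.s≤s (proj₂ (∈-arc⁻ i m f∈F)))

        -- An arrow disjoint from the interval leaves it inside the arc between the ends, and
        -- closure is monotone. The element `a` makes that arc nonempty, as `arrow-unspanned`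
        -- requires.
        arrow-unspanned-interval : ∀ i a b {x} → x ∈ ⟦ π ⟨$⟩ʳ i , i ⟧ → ⟦ π ⟨$⟩ʳ i , i ⟧ ⊆ ∁ ⟦ a , b ⟧ →
          ¬ Spans M ⟦ a , b ⟧ x
        arrow-unspanned-interval i a b x∈arrow arrow⊆∁E x∈clE =
          arrow-unspanned i m y≡1+m (E⊆F a∈E) x∈arrow (spans-mono M ∣basis∣≡d E⊆F x∈clE)
          where
          y = π ⟨$⟩ʳ i
          y≢i : y ≢ i
          y≢i = proj₁ (decorated i)
          m = ℕ.pred (steps i y)
          y≡1+m : steps i y ≡ ℕ.suc m
          y≡1+m = sym (ℕₚ.suc-pred (steps i y) {{ℕ.>-nonZero (steps>0 y≢i)}})
          a∈E : a ∈ ⟦ a , b ⟧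
          a∈E = ∈-⟦⟧⁺ a b (subst (ℕ._≤ steps a b) (sym (steps-refl a)) ℕ.z≤n)
          E⊆F : ⟦ a , b ⟧ ⊆ arc i m
          E⊆F {z} z∈E = decidable-stable (z ∈? arc i m)
            λ z∉F → x∈∁p⇒x∉p (arrow⊆∁E (∉-arc⇒∈-arrow y≢i y≡1+m z∉F)) z∈E

        covered⇒flat : ∀ a b → CoveredByCCWArrows π (∁ ⟦ a , b ⟧) → IsFlat M ⟦ a , b ⟧
        covered⇒flat a b covered x x∉E = unspanned (covered x (x∉p⇒x∈∁p x∉E))
          where
          unspanned : ∃[ T ] IsCCWArrow π T × x ∈ T × T ⊆ ∁ ⟦ a , b ⟧ → r ⟦ a , b ⟧ ℕ.< r (⟦ a , b ⟧ ⊕ x)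
          unspanned (T , (y , T≡) , x∈T , T⊆∁E) = ℕₚ.≰⇒> (arrow-unspanned-interval (π ⟨$⟩ˡ y) a b
            (subst (x ∈_) T≡arrow x∈T) (subst (_⊆ ∁ ⟦ a , b ⟧) T≡arrow T⊆∁E))
            where
            T≡arrow : T ≡ ⟦ π ⟨$⟩ʳ (π ⟨$⟩ˡ y) , π ⟨$⟩ˡ y ⟧
            T≡arrow = trans T≡ (cong ⟦_, π ⟨$⟩ˡ y ⟧ (sym (inverseʳ π)))

theorem4p2 : (n : ℕ) (M : Matroid n) → IsPositroid M → Loopless M → Coloopless M →
    (π : Permutation′ n) → IsDecoratedPermutation M π →
    (E : Subset n) → IsCyclicInterval E →
    IsFlat M E ⇔ CoveredByCCWArrows π (∁ E)
theorem4p2 n M (d , positroid) loopless coloopless π decorated _ (a , b , refl) = mk⇔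
  (flat⇒covered M (∣basis∣ M positroid) π decorated coloopless a b)
  (covered⇒flat M (∣basis∣ M positroid) π decorated (noncrossing M positroid) loopless a b)
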